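{- Let $n=|Ag|\geq 1$ and $\mathsf{X}\subseteq\{\mathbf{D2},\mathbf{D3},\mathbf{D4},\mathbf{D5}\}$. If a sequent $\Lambda$ is valid relative to $\mathsf{DS}_{n}\mathsf{X}$, then $\Lambda$ is derivable in $\mathsf{G3DS}_{n}\mathsf{X}$.
   Context: Language $\mathcal{L}_n$: $Ag=\{1,\dots,n\}$, $Atm$ countable set of atoms; formulas (negation normal form) $\phi::=p\mid\neg p\mid\phi\lor\phi\mid\phi\land\phi\mid\Box\phi\mid\Diamond\phi\mid[i]\phi\mid\langle i\rangle\phi\mid\otimes_i\phi\mid\ominus_i\phi$. A $\mathsf{DS}_n$-frame is $\langle W,R_\Box,\{R_{[i]}\}_{i\in Ag},\{R_{\otimes_i}\}_{i\in Ag}\rangle$, $W\neq\emptyset$, with: (C1) $R_\Box$ an equivalence relation; (C2) each $R_{[i]}\subseteq R_\Box$ an equivalence relation; (C3) for all $w$ and $u_1,\dots,u_n\in R_\Box(w)$, $\bigcap_i R_{[i]}(u_i)\neq\emptyset$; (D1) $R_\Box wv$ and $R_{\otimes_i}wu$ imply $R_{\otimes_i}vu$. Optional: (D2) each $w$ has an $R_{\otimes_i}$-successor; (D3) $R_{\otimes_i}\subseteq R_\Box$; (D4) $R_{\otimes_i}wv$, $R_{[i]}vu$ imply $R_{\otimes_i}wu$; (D5) each $w$ has $v$ with $R_{\otimes_i}wv$ and $R_{[i]}(v)\subseteq R_{\otimes_i}(w)$. $\mathsf{DS}_n\mathsf{X}$-frames additionally satisfy the properties in $\mathsf{X}$ (for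 all $i$); models add $V:Atm\to\mathcal{P}(W)$; $\Box,[i],\otimes_i$ are interpreted universally and $\Diamond,\langle i\rangle,\ominus_i$ existentially over $R_\Box,R_{[i]},R_{\otimes_i}$; literals, $\land,\lor$ classically. Sequents $\mathcal{R}\vdash\Gamma$: $\mathcal{R}$ a multiset of relational atoms $R_\Box xy,R_{[i]}xy,R_{\otimes_i}xy$, $\Gamma$ a multiset of labelled formulas $x:\phi$. For model $M$ and $I$ from labels to worlds, $M,I\models\mathcal{R}\vdash\Gamma$ iff, whenever all atoms of $\mathcal{R}$ hold under $I$, some $z:\phi\in\Gamma$ has $M,I(z)\Vdash\phi$; valid relative to $\mathsf{DS}_n\mathsf{X}$ means this holds for all $\mathsf{DS}_n\mathsf{X}$-models and all $I$. Paths: $x\sim^{\mathcal{R}}_i y$ iff $x=y$ or $x,y$ are connected by a chain of $R_{[i]}$-atoms of $\mathcal{R}$ taken in either direction; $x\sim^{\mathcal{R}}_\Diamond y$ likewise with $R_\Box$- or any $R_{[j]}$-atoms. Calculus $\mathsf{G3DS}_n$ (premise(s) $\Rightarrow$ conclusion; fresh = not in conclusion): (id) $\mathcal{R}\vdash x:p,x:\neg p,\Gamma$; ($\lor$) $x:\phi,x:\psi\Rightarrow x:\phi\lor\psi$; ($\land$) two premises $x:\phi$, $x:\psi\Rightarrow x:\phi\land\psi$; ($\Box$) $\mathcal{R},R_\Box xy\vdash y:\phi,\Gamma\Rightarrow\mathcal{R}\vdash x:\Box\phi,\Gamma$, $y$ fresh; ($\Diamond$) $\mathcal{R}\vdash x:\Diamond\phi,y:\phi,\Gamma\Rightarrow\mathcal{R}\vdash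 x:\Diamond\phi,\Gamma$ if $x\sim^{\mathcal{R}}_\Diamond y$; ($[i]$) analogous to ($\Box$) with $R_{[i]}$; ($\langle i\rangle$) analogous to ($\Diamond$) with condition $x\sim^{\mathcal{R}}_i y$; ($\otimes_i$) analogous to ($\Box$) with $R_{\otimes_i}$; ($\ominus_i$) $\mathcal{R},R_{\otimes_i}xy\vdash x:\ominus_i\phi,y:\phi,\Gamma\Rightarrow\mathcal{R},R_{\otimes_i}xy\vdash x:\ominus_i\phi,\Gamma$; (IOA) $\mathcal{R},R_{[1]}x_1y,\dots,R_{[n]}x_ny\vdash\Gamma\Rightarrow\mathcal{R}\vdash\Gamma$, $y$ fresh, $x_j\sim^{\mathcal{R}}_\Diamond x_{j+1}$ for all $j$; (D1$_i$) $\mathcal{R},R_{\otimes_i}xz,R_{\otimes_i}yz\vdash\Gamma\Rightarrow\mathcal{R},R_{\otimes_i}xz\vdash\Gamma$ if $x\sim^{\mathcal{R}}_\Diamond y$. Extra rules: (D2$_i$) $\mathcal{R},R_{\otimes_i}xy\vdash\Gamma\Rightarrow\mathcal{R}\vdash\Gamma$, $y$ fresh; (D3$_i$) $\mathcal{R},R_{\otimes_i}xy,R_\Box xy\vdash\Gamma\Rightarrow\mathcal{R},R_{\otimes_i}xy\vdash\Gamma$; (D4$_i$) $\mathcal{R},R_{\otimes_i}xy,R_{\otimes_i}xz\vdash\Gamma\Rightarrow\mathcal{R},R_{\otimes_i}xy\vdash\Gamma$ if $y\sim^{\mathcal{R}}_i z$; (D5$_i$) the system of (D5$^1_i$) $\mathcal{R},R_{\otimes_i}xy\vdash\Gamma\Rightarrow\mathcal{R}\vdash\Gamma$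 ($y$ fresh) and (D5$^2_i$) $\mathcal{R}',R_{\otimes_i}xz\vdash\Gamma'\Rightarrow\mathcal{R}'\vdash\Gamma'$ where $y\sim^{\mathcal{R}'}_i z$ and $R_{\otimes_i}xy$ was introduced by an application of (D5$^1_i$) further down in the derivation. $\mathsf{G3DS}_n\mathsf{X}$ is $\mathsf{G3DS}_n$ plus (D$K_i$) for all $i$ whenever $\mathbf{D}K\in\mathsf{X}$. Derivations are finite trees with (id) leaves. -}

module Defs where

open import Data.Nat using (ℕ; suc)
open import Data.Fin using (Fin; toℕ)
open import Data.Bool using (Bool)
open import Data.Unit using (⊤)
open import Data.Empty using (⊥)
open import Data.Product using (Σ; ∃; _×_; _,_)
open import Data.Sum using (_⊎_)
open import Data.List using (List; []; _∷_; map; _++_; allFin)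
open import Data.List.Membership.Propositional using (_∈_)
open import Data.List.Relation.Unary.Any using (Any)
open import Data.List.Relation.Unary.All using (All)
open import Data.List.Relation.Binary.Permutation.Propositional using (_↭_)
open import Relation.Nullary using (¬_)
open import Relation.Binary.PropositionalEquality using (_≡_)
open import Relation.Binary.Structures using (IsEquivalence)
open import Data.Bool using (T)

-- Syntax.  Agents Ag = Fin n (agent i+1 of the paper is the i-th element
-- of Fin n); atoms Atm = ℕ (a countable set); labels are ℕ.

Atm : Set
Atm = ℕ

Label : Set
Label = ℕ

data Fm (n : ℕ) : Set where
  atom  : Atm → Fm n
  natom : Atm → Fm n
  _∨ᶠ_  : Fm n → Fm n → Fm n
  _∧ᶠ_  : Fm n → Fm n → Fm n
  □ᶠ    : Fm n → Fm n
  ◇ᶠ    : Fm n → Fm n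
  [_]ᶠ  : Fin n → Fm n → Fm n
  ⟨_⟩ᶠ  : Fin n → Fm n → Fm n
  ⊗ᶠ    : Fin n → Fm n → Fm n
  ⊖ᶠ    : Fin n → Fm n → Fm n

data RAtom (n : ℕ) : Set where
  R□  : Label → Label → RAtom n
  R[] : Fin n → Label → Label → RAtom n
  R⊗  : Fin n → Label → Label → RAtom n

record LFm (n : ℕ) : Set where
  constructor _∶_
  field
    lab : Label
    fm  : Fm n

-- A sequent R ⊢ Γ is a pair of multisets, represented by lists; every rule
-- below matches its conclusion only up to permutation (_↭_) or membership,
-- so derivability depends only on the underlying multisets.

record Ext : Set where
  field
    d2 d3 d4 d5 : Bool
open Ext public

OccR : ∀ {n} → Label → RAtom n → Set
OccR y (R□ a b)    = y ≡ a ⊎ y ≡ b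
OccR y (R[] _ a b) = y ≡ a ⊎ y ≡ b
OccR y (R⊗ _ a b)  = y ≡ a ⊎ y ≡ b

Fresh : ∀ {n} → Label → List (RAtom n) → List (LFm n) → Set
Fresh y R Γ = ¬ Any (OccR y) R × ¬ Any (λ A → y ≡ LFm.lab A) Γ

data _∼[_∣_]_ {n : ℕ} : Label → Fin n → List (RAtom n) → Label → Set where
  ∼refl : ∀ {x i R} → x ∼[ i ∣ R ] x
  ∼fwd  : ∀ {x y z i R} → R[] i x y ∈ R → y ∼[ i ∣ R ] z → x ∼[ i ∣ R ] z
  ∼bwd  : ∀ {x y z i R} → R[] i y x ∈ R → y ∼[ i ∣ R ] z → x ∼[ i ∣ R ] z

data _∼◇[_]_ {n : ℕ} : Label → List (RAtom n) → Label → Set where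
  ◇refl  : ∀ {x R} → x ∼◇[ R ] x
  ◇fwd□  : ∀ {x y z R} → R□ x y ∈ R → y ∼◇[ R ] z → x ∼◇[ R ] z
  ◇bwd□  : ∀ {x y z R} → R□ y x ∈ R → y ∼◇[ R ] z → x ∼◇[ R ] z
  ◇fwd[] : ∀ {x y z j R} → R[] j x y ∈ R → y ∼◇[ R ] z → x ∼◇[ R ] z
  ◇bwd[] : ∀ {x y z j R} → R[] j y x ∈ R → y ∼◇[ R ] z → x ∼◇[ R ] z

-- The calculus G3DS_n X.
-- The index H records the atoms R_⊗i x y introduced by (D5¹_i) further
-- down the current branch (needed for the side condition of (D5²_i)).

D5Hist : ℕ → Set
D5Hist n = List (Fin n × Label × Label)

data Der {n : ℕ} (X : Ext) : D5Hist n → List (RAtom n) → List (LFm n) → Set where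
  ax   : ∀ {H R Γ x p} → (x ∶ atom p) ∈ Γ → (x ∶ natom p) ∈ Γ → Der X H R Γ
  ∨R   : ∀ {H R Γ Γ' x φ ψ} → Γ ↭ ((x ∶ (φ ∨ᶠ ψ)) ∷ Γ') →
         Der X H R ((x ∶ φ) ∷ (x ∶ ψ) ∷ Γ') → Der X H R Γ
  ∧R   : ∀ {H R Γ Γ' x φ ψ} → Γ ↭ ((x ∶ (φ ∧ᶠ ψ)) ∷ Γ') →
         Der X H R ((x ∶ φ) ∷ Γ') → Der X H R ((x ∶ ψ) ∷ Γ') → Der X H R Γ
  □R   : ∀ {H R Γ Γ' x y φ} → Γ ↭ ((x ∶ □ᶠ φ) ∷ Γ') → Fresh y R Γ →
         Der X H (R□ x y ∷ R) ((y ∶ φ) ∷ Γ') → Der X H R Γ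
  ◇R   : ∀ {H R Γ x y φ} → (x ∶ ◇ᶠ φ) ∈ Γ → x ∼◇[ R ] y →
         Der X H R ((y ∶ φ) ∷ Γ) → Der X H R Γ
  []R  : ∀ {H R Γ Γ' x y i φ} → Γ ↭ ((x ∶ [ i ]ᶠ φ) ∷ Γ') → Fresh y R Γ →
         Der X H (R[] i x y ∷ R) ((y ∶ φ) ∷ Γ') → Der X H R Γ
  ⟨⟩R  : ∀ {H R Γ x y i φ} → (x ∶ ⟨ i ⟩ᶠ φ) ∈ Γ → x ∼[ i ∣ R ] y →
         Der X H R ((y ∶ φ) ∷ Γ) → Der X H R Γ
  ⊗R   : ∀ {H R Γ Γ' x y i φ} → Γ ↭ ((x ∶ ⊗ᶠ i φ) ∷ Γ') → Fresh y R Γ →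
         Der X H (R⊗ i x y ∷ R) ((y ∶ φ) ∷ Γ') → Der X H R Γ
  ⊖R   : ∀ {H R Γ x y i φ} → R⊗ i x y ∈ R → (x ∶ ⊖ᶠ i φ) ∈ Γ →
         Der X H R ((y ∶ φ) ∷ Γ) → Der X H R Γ
  -- (IOA): xs j is the label x_{j+1}
  IOA  : ∀ {H R Γ y} (xs : Fin n → Label) → Fresh y R Γ →
         (∀ (j k : Fin n) → toℕ k ≡ suc (toℕ j) → xs j ∼◇[ R ] xs k) →
         Der X H (map (λ j → R[] j (xs j) y) (allFin n) ++ R) Γ → Der X H R Γ
  D1   : ∀ {H R Γ x y z i} → R⊗ i x z ∈ R → x ∼◇[ R ] y →
         Der X H (R⊗ i y z ∷ R) Γ → Der X H R Γ
  D2   : ∀ {H R Γ x y i} → T (d2 X) → Fresh y R Γ →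
         Der X H (R⊗ i x y ∷ R) Γ → Der X H R Γ
  D3   : ∀ {H R Γ x y i} → T (d3 X) → R⊗ i x y ∈ R →
         Der X H (R□ x y ∷ R) Γ → Der X H R Γ
  D4   : ∀ {H R Γ x y z i} → T (d4 X) → R⊗ i x y ∈ R → y ∼[ i ∣ R ] z →
         Der X H (R⊗ i x z ∷ R) Γ → Der X H R Γ
  D5¹  : ∀ {H R Γ x y i} → T (d5 X) → Fresh y R Γ →
         Der X ((i , x , y) ∷ H) (R⊗ i x y ∷ R) Γ → Der X H R Γ
  D5²  : ∀ {H R Γ x y z i} → T (d5 X) → (i , x , y) ∈ H → y ∼[ i ∣ R ] z →
         Der X H (R⊗ i x z ∷ R) Γ → Der X H R Γ

Derivable : ∀ {n} → Ext → List (RAtom n) → List (LFm n) → Set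
Derivable X R Γ = Der X [] R Γ

record DSFrame (n : ℕ) : Set₁ where
  field
    W    : Set
    w₀   : W                               -- W ≠ ∅
    Rb   : W → W → Set
    Ra   : Fin n → W → W → Set
    Ro   : Fin n → W → W → Set
    C1   : IsEquivalence Rb
    C2eq : ∀ i → IsEquivalence (Ra i)
    C2⊆  : ∀ i {w v} → Ra i w v → Rb w v
    C3   : ∀ w (u : Fin n → W) → (∀ i → Rb w (u i)) →
           ∃ λ v → ∀ i → Ra i (u i) v
    D1f  : ∀ i {w v u} → Rb w v → Ro i w u → Ro i v u

record SatX {n : ℕ} (X : Ext) (F : DSFrame n) : Set where
  open DSFrame F
  field
    D2f : T (d2 X) → ∀ i w → ∃ λ v → Ro i w v
    D3f : T (d3 X) → ∀ i {w v} → Ro i w v → Rb w v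
    D4f : T (d4 X) → ∀ i {w v u} → Ro i w v → Ra i v u → Ro i w u
    D5f : T (d5 X) → ∀ i w → ∃ λ v → Ro i w v × (∀ u → Ra i v u → Ro i w u)

record DSModel (n : ℕ) : Set₁ where
  field
    frame : DSFrame n
  open DSFrame frame public
  field
    V : Atm → W → Set

module _ {n : ℕ} (M : DSModel n) where
  open DSModel M

  _⊩_ : W → Fm n → Set
  w ⊩ atom p    = V p w
  w ⊩ natom p   = ¬ V p w
  w ⊩ (φ ∨ᶠ ψ)  = w ⊩ φ ⊎ w ⊩ ψ
  w ⊩ (φ ∧ᶠ ψ)  = w ⊩ φ × w ⊩ ψ
  w ⊩ □ᶠ φ      = ∀ v → Rb w v → v ⊩ φ
  w ⊩ ◇ᶠ φ      = ∃ λ v → Rb w v × v ⊩ φ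
  w ⊩ [ i ]ᶠ φ  = ∀ v → Ra i w v → v ⊩ φ
  w ⊩ ⟨ i ⟩ᶠ φ  = ∃ λ v → Ra i w v × v ⊩ φ
  w ⊩ ⊗ᶠ i φ    = ∀ v → Ro i w v → v ⊩ φ
  w ⊩ ⊖ᶠ i φ    = ∃ λ v → Ro i w v × v ⊩ φ

  HoldsR : (Label → W) → RAtom n → Set
  HoldsR I (R□ x y)    = Rb (I x) (I y)
  HoldsR I (R[] i x y) = Ra i (I x) (I y)
  HoldsR I (R⊗ i x y)  = Ro i (I x) (I y)

  SatSeq : (Label → W) → List (RAtom n) → List (LFm n) → Set
  SatSeq I R Γ = All (HoldsR I) R → Any (λ A → I (LFm.lab A) ⊩ LFm.fm A) Γ

Valid : ∀ {n} → Ext → List (RAtom n) → List (LFm n) → Set₁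
Valid {n} X R Γ = ∀ (M : DSModel n) → SatX X (DSModel.frame M) →
                  ∀ (I : Label → DSModel.W M) → SatSeq M I R Γ

{-# OPTIONS --safe #-}
-- The rules are applied backwards to the given sequent in a search that terminates.  New labels
-- are named by the rule application that introduces them.  Inside a □-cluster a name has a rank,
-- its distance from the origin of the cluster, and when D3 is absent ⊗-successors open a cluster
-- of the next level.  Levels are bounded by the nesting depth of ⊗ and ⊖, and ranks by the number
-- of types, a type being the bounded amount of information about a label that the countermodel
-- has to preserve.  So there are finitely many possible facts about labels and every step adds
-- one.  In a search state that is saturated and not closed, each cluster has a rank k such that
-- all types realised up to rank k + 1 are realised up to rank k.  The labels of rank at most k
-- form a finite countermodel: a witness of rank k + 1 is replaced by a label of the same type,
-- and [i]-classes are enlarged to all labels of the cluster that agree on the information that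
-- [i]-paths propagate.  Enlarging the classes keeps independence of agents, since (IOA) labels
-- are replaced in the same way.  No step of this argument is classical.
module Submission where

open import Defs
open import Data.Nat using (ℕ; _≤_; zero; suc; _+_; _*_; _⊔_; _<_; z≤n; s≤s; _≤?_; _<?_)
open import Data.Nat.Properties as ℕₚ using (≤-trans; ≤-refl; ≤-reflexive; m≤m+n; m≤n+m; m≤m⊔n; m≤n⊔m; +-monoˡ-≤; +-monoʳ-≤)
open import Data.Nat.ListAction using (sum)
open import Data.Nat.Induction using (<-wellFounded)
open import Induction.WellFounded using (Acc; acc)
open import Data.Fin using (Fin; zero; suc)
open import Data.Fin.Properties as Finₚ using (all?)
open import Data.Bool using (Bool; true; false; T; if_then_else_)
open import Data.Bool.Properties as Boolₚ using (T?)
open import Data.Unit using (⊤; tt)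
open import Data.Empty using (⊥)
open import Data.Maybe using (Maybe; just; nothing)
open import Data.Maybe.Properties as Maybeₚ using ()
open import Data.Product using (Σ; ∃; ∃₂; _×_; _,_; proj₁; proj₂; map₂)
open import Data.Product.Properties as ×ₚ using ()
open import Data.Sum using (_⊎_; inj₁; inj₂; [_,_]′; swap)
open import Data.Sum.Properties as ⊎ₚ using ()
open import Data.Vec using (Vec; []; _∷_; lookup; tabulate)
open import Data.Vec.Properties using (lookup∘tabulate)
open import Data.List using (List; []; _∷_; _++_; map; concat; length; allFin; cartesianProduct; cartesianProductWith)
open import Data.List.Properties as Listₚ using (length-map; ∷-injective)
open import Data.List.Membership.Propositional using (_∈_; _∉_; lose; find)
open import Data.List.Membership.Propositional.Properties using (∈-++⁺ˡ; ∈-++⁺ʳ; ∈-++⁻; ∈-map⁺; ∈-map⁻; ∈-concat⁺′; ∈-cartesianProduct⁺; ∈-cartesianProductWith⁺; ∈-allFin; ∈-∃++)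
import Data.List.Membership.DecPropositional as DecMembership
open import Data.List.Relation.Binary.Subset.Propositional using (_⊆_)
open import Data.List.Relation.Unary.Any as Any using (Any; here; there; any?)
import Data.List.Relation.Unary.Any.Properties as Anyₚ
open import Data.List.Relation.Unary.All as All using (All; []; _∷_)
import Data.List.Relation.Unary.All.Properties as Allₚ
open import Data.List.Relation.Binary.Permutation.Propositional using (_↭_; ↭-sym)
open import Data.List.Relation.Binary.Permutation.Propositional.Properties using (∈-resp-↭; shift)
open import Function using (_∘_; id; case_of_)
open import Relation.Nullary using (¬_; Dec; yes; no; does; contradiction; _×-dec_)
open import Relation.Nullary.Decidable using (map′)
open import Relation.Unary using (Decidable)
open import Relation.Binary.Definitions using (DecidableEquality)
open import Relation.Binary.PropositionalEquality using (_≡_; _≢_; refl; sym; trans; cong; cong₂; subst)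

-- Finite lists

-- The rules for `∨`, `∧`, `□`, `[i]` and `⊗` delete their principal formula, so the sequents met in
-- the search do not simply grow. Progress is therefore measured on a separate set of facts that
-- only grows; a deleted formula leaves the facts of its decomposition behind. The obstacle is to
-- bound a type. Replacing a witness by another label destroys the paths leading to it, so a type
-- must carry whatever a path would transmit: which `⟨i⟩` formulas act (`Dia`) and which [i]-classes
-- consist of ⊗-successors (`OughtCell`). Incoming ⊗-edges could have unboundedly many sources, but
-- by (D1) they depend on the source cluster only, so a fixed list of canonical sources is enough.
-- `OughtCell` is kept apart from `Ought` because without (D4) only the successors made by (D5¹)
-- spread over their [i]-class, and (D5²) has to start from exactly those. In the countermodel the
-- truth of a formula is only ever refuted, and saturation is decidable; hence validity is
-- contradicted at every saturated state without classical reasoning.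

when : {P A : Set} → Dec P → (P → A) → List A
when (yes p) f = f p ∷ []
when (no _)  f = []

-- The decision may carry a different proof from the given one, hence the existential.
∈-when : {P A : Set} (d : Dec P) {f : P → A} → P → ∃ λ p → f p ∈ when d f
∈-when (yes p) _ = p , here refl
∈-when (no ¬p) p = contradiction p ¬p

infixr 1 _⊎ᴸ_

abstract

  _⊎ᴸ_ : {A B : Set} → List A → List B → List (A ⊎ B)
  xs ⊎ᴸ ys = map inj₁ xs ++ map inj₂ ys

  ∈-⊎ᴸˡ : {A B : Set} {xs : List A} {ys : List B} {x : A} → x ∈ xs → inj₁ x ∈ (xs ⊎ᴸ ys)
  ∈-⊎ᴸˡ p = ∈-++⁺ˡ (∈-map⁺ inj₁ p)

  ∈-⊎ᴸʳ : {A B : Set} {xs : List A} {ys : List B} {y : B} → y ∈ ys → inj₂ y ∈ (xs ⊎ᴸ ys)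
  ∈-⊎ᴸʳ {xs = xs} p = ∈-++⁺ʳ (map inj₁ xs) (∈-map⁺ inj₂ p)

vecs : {A : Set} → List A → ∀ k → List (Vec A k)
vecs xs zero    = [] ∷ []
vecs xs (suc k) = cartesianProductWith _∷_ xs (vecs xs k)

∈-vecs : {A : Set} {xs : List A} {k : ℕ} (v : Vec A k) → (∀ j → lookup v j ∈ xs) → v ∈ vecs xs k
∈-vecs []      h = here refl
∈-vecs (x ∷ v) h = ∈-cartesianProductWith⁺ _∷_ (h zero) (∈-vecs v (h ∘ suc))

bitLists : ℕ → List (List Bool)
bitLists zero    = [] ∷ []
bitLists (suc k) = map (true ∷_) (bitLists k) ++ map (false ∷_) (bitLists k)

∈-bitLists : (bs : List Bool) → bs ∈ bitLists (length bs)
∈-bitLists []           = here refl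
∈-bitLists (true ∷ bs)  = ∈-++⁺ˡ (∈-map⁺ (true ∷_) (∈-bitLists bs))
∈-bitLists (false ∷ bs) = ∈-++⁺ʳ _ (∈-map⁺ (false ∷_) (∈-bitLists bs))

∈⇒≤sum : ∀ {k ks} → k ∈ ks → k ≤ sum ks
∈⇒≤sum {ks = _ ∷ ks} (here refl) = m≤m+n _ (sum ks)
∈⇒≤sum {ks = k ∷ _}  (there p)   = ≤-trans (∈⇒≤sum p) (m≤n+m _ k)

map-≡⇒∈-≡ : {A B : Set} {f g : A → B} {xs : List A} {x : A} → map f xs ≡ map g xs → x ∈ xs → f x ≡ g x
map-≡⇒∈-≡ eq (here refl) = proj₁ (∷-injective eq)
map-≡⇒∈-≡ eq (there p)   = map-≡⇒∈-≡ (proj₂ (∷-injective eq)) p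

extract : {A : Set} {x : A} {xs : List A} → x ∈ xs → ∃ λ ys → xs ↭ x ∷ ys
extract p with ys , zs , refl ← ∈-∃++ p = ys ++ zs , shift _ ys zs

-- Counting missing elements: the measure for termination and stabilisation

missing : {A : Set} {P : A → Set} → Decidable P → List A → ℕ
missing P? []       = 0
missing P? (x ∷ xs) = if does (P? x) then missing P? xs else suc (missing P? xs)

missing≤length : {A : Set} {P : A → Set} (P? : Decidable P) → ∀ xs → missing P? xs ≤ length xs
missing≤length P? [] = z≤n
missing≤length P? (x ∷ xs) with P? x
... | yes _ = ℕₚ.m≤n⇒m≤1+n (missing≤length P? xs)
... | no _  = s≤s (missing≤length P? xs)

module _ {A : Set} {P Q : A → Set} (P? : Decidable P) (Q? : Decidable Q) (P⊆Q : ∀ {x} → P x → Q x) where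

  missing-mono : ∀ xs → missing Q? xs ≤ missing P? xs
  missing-mono [] = z≤n
  missing-mono (x ∷ xs) with P? x | Q? x
  ... | yes _ | yes _ = missing-mono xs
  ... | yes p | no ¬q = contradiction (P⊆Q p) ¬q
  ... | no _  | yes _ = ℕₚ.m≤n⇒m≤1+n (missing-mono xs)
  ... | no _  | no _  = s≤s (missing-mono xs)

  missing-< : ∀ {x xs} → x ∈ xs → Q x → ¬ P x → missing Q? xs < missing P? xs
  missing-< {x} {.x ∷ xs} (here refl) q ¬p with P? x | Q? x
  ... | yes p | _     = contradiction p ¬p
  ... | no _  | no ¬q = contradiction q ¬q
  ... | no _  | yes _ = s≤s (missing-mono xs)
  missing-< {x} {y ∷ xs} (there i) q ¬p with P? y | Q? y
  ... | yes _ | yes _ = missing-< i q ¬p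
  ... | yes p | no ¬q = contradiction (P⊆Q p) ¬q
  ... | no _  | yes _ = ℕₚ.m≤n⇒m≤1+n (missing-< i q ¬p)
  ... | no _  | no _  = s≤s (missing-< i q ¬p)

module _ {A : Set} {P : ℕ → A → Set} (P? : ∀ k → Decidable (P k)) (P-mono : ∀ {k x} → P k x → P (suc k) x) (xs : List A) where

  private
    Stable : ℕ → Set
    Stable k = ∀ {x} → x ∈ xs → P (suc k) x → P k x

    stable⊎new : ∀ k x → (P (suc k) x → P k x) ⊎ (P (suc k) x × ¬ P k x)
    stable⊎new k x with P? k x | P? (suc k) x
    ... | yes p | _     = inj₁ λ _ → p
    ... | no _  | no ¬q = inj₁ λ q → contradiction q ¬q
    ... | no ¬p | yes q = inj₂ (q , ¬p)

    go : ∀ fuel k → missing (P? k) xs ≤ fuel → ∃ λ k′ → k′ ≤ fuel + k × Stable k′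
    go fuel k h with All.decide (stable⊎new k) xs
    ... | inj₁ ok = k , m≤n+m k fuel , λ i → All.lookup ok i
    ... | inj₂ new with find new
    ...   | x , i , q , ¬p with fuel | ≤-trans (missing-< (P? k) (P? (suc k)) P-mono i q ¬p) h
    ...     | suc fuel′ | s≤s h′ with go fuel′ (suc k) h′
    ...       | k′ , le , st = k′ , ≤-trans le (≤-reflexive (ℕₚ.+-suc fuel′ k)) , st

  -- Each unstable k lowers the number of entries of `xs` outside `P k`, and this number is at most
  -- `length xs` at the start. It is applied to the types realised up to rank k.
  stabilise : ∃ λ k → k ≤ length xs × (∀ {x} → x ∈ xs → P (suc k) x → P k x)
  stabilise with k , le , st ← go (length xs) 0 (missing≤length (P? 0) xs) =
    k , ≤-trans le (≤-reflexive (ℕₚ.+-identityʳ (length xs))) , st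

-- Formulas

module _ {n : ℕ} where

  private
    -- Comparing formulas directly takes a clause for every pair of ten constructors. Trees have
    -- two, and a left inverse of an embedding into them transfers decidability.
    data Tree : Set where
      leaf : Tree
      node : ℕ × Maybe (Fin n) → Tree → Tree → Tree

    _≟ᵗ_ : DecidableEquality Tree
    leaf ≟ᵗ leaf = yes refl
    leaf ≟ᵗ node _ _ _ = no λ ()
    node _ _ _ ≟ᵗ leaf = no λ ()
    node k s t ≟ᵗ node k′ s′ t′ =
      map′ (λ { (refl , refl , refl) → refl }) (λ { refl → refl , refl , refl })
        (×ₚ.≡-dec ℕₚ._≟_ (Maybeₚ.≡-dec Finₚ._≟_) k k′ ×-dec (s ≟ᵗ s′ ×-dec t ≟ᵗ t′))

    -- An agent in the tag marks the indexed modalities. Otherwise two leaves mark an atom, a leaf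
    -- followed by a node a negated atom, and a node on the left one of `∨`, `∧`, `□`, `◇`, told
    -- apart by the number.
    encode : Fm n → Tree
    encode (atom p)    = node (p , nothing) leaf leaf
    encode (natom p)   = node (p , nothing) leaf (node (0 , nothing) leaf leaf)
    encode (φ ∨ᶠ ψ)    = node (0 , nothing) (node (0 , nothing) leaf leaf) (node (0 , nothing) (encode φ) (encode ψ))
    encode (φ ∧ᶠ ψ)    = node (1 , nothing) (node (0 , nothing) leaf leaf) (node (0 , nothing) (encode φ) (encode ψ))
    encode (□ᶠ φ)      = node (2 , nothing) (node (0 , nothing) leaf leaf) (encode φ)
    encode (◇ᶠ φ)      = node (3 , nothing) (node (0 , nothing) leaf leaf) (encode φ)
    encode ([ i ]ᶠ φ)  = node (0 , just i) leaf (encode φ)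
    encode (⟨ i ⟩ᶠ φ)  = node (1 , just i) leaf (encode φ)
    encode (⊗ᶠ i φ)    = node (2 , just i) leaf (encode φ)
    encode (⊖ᶠ i φ)    = node (3 , just i) leaf (encode φ)

    decode : Tree → Fm n
    decode (node (p , nothing) leaf leaf) = atom p
    decode (node (p , nothing) leaf (node _ _ _)) = natom p
    decode (node (0 , nothing) (node _ _ _) (node _ s t)) = decode s ∨ᶠ decode t
    decode (node (1 , nothing) (node _ _ _) (node _ s t)) = decode s ∧ᶠ decode t
    decode (node (2 , nothing) (node _ _ _) t) = □ᶠ (decode t)
    decode (node (3 , nothing) (node _ _ _) t) = ◇ᶠ (decode t)
    decode (node (0 , just i) _ t) = [ i ]ᶠ (decode t)
    decode (node (1 , just i) _ t) = ⟨ i ⟩ᶠ (decode t)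
    decode (node (2 , just i) _ t) = ⊗ᶠ i (decode t)
    decode (node (3 , just i) _ t) = ⊖ᶠ i (decode t)
    decode _ = atom 0

    decode-encode : ∀ φ → decode (encode φ) ≡ φ
    decode-encode (atom p)   = refl
    decode-encode (natom p)  = refl
    decode-encode (φ ∨ᶠ ψ)   = cong₂ _∨ᶠ_ (decode-encode φ) (decode-encode ψ)
    decode-encode (φ ∧ᶠ ψ)   = cong₂ _∧ᶠ_ (decode-encode φ) (decode-encode ψ)
    decode-encode (□ᶠ φ)     = cong □ᶠ (decode-encode φ)
    decode-encode (◇ᶠ φ)     = cong ◇ᶠ (decode-encode φ)
    decode-encode ([ i ]ᶠ φ) = cong [ i ]ᶠ (decode-encode φ)
    decode-encode (⟨ i ⟩ᶠ φ) = cong ⟨ i ⟩ᶠ (decode-encode φ)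
    decode-encode (⊗ᶠ i φ)   = cong (⊗ᶠ i) (decode-encode φ)
    decode-encode (⊖ᶠ i φ)   = cong (⊖ᶠ i) (decode-encode φ)

  _≟ᶠ_ : DecidableEquality (Fm n)
  φ ≟ᶠ ψ = map′ (λ eq → trans (sym (decode-encode φ)) (trans (cong decode eq) (decode-encode ψ)))
                (cong encode) (encode φ ≟ᵗ encode ψ)

  data _◁_ : Fm n → Fm n → Set where
    ∨ˡ : ∀ {φ ψ} → φ ◁ (φ ∨ᶠ ψ)
    ∨ʳ : ∀ {φ ψ} → ψ ◁ (φ ∨ᶠ ψ)
    ∧ˡ : ∀ {φ ψ} → φ ◁ (φ ∧ᶠ ψ)
    ∧ʳ : ∀ {φ ψ} → ψ ◁ (φ ∧ᶠ ψ)
    □◁ : ∀ {φ} → φ ◁ □ᶠ φ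
    ◇◁ : ∀ {φ} → φ ◁ ◇ᶠ φ
    []◁ : ∀ {i φ} → φ ◁ [ i ]ᶠ φ
    ⟨⟩◁ : ∀ {i φ} → φ ◁ ⟨ i ⟩ᶠ φ
    ⊗◁ : ∀ {i φ} → φ ◁ ⊗ᶠ i φ
    ⊖◁ : ∀ {i φ} → φ ◁ ⊖ᶠ i φ

  subformulas properSubformulas : Fm n → List (Fm n)
  subformulas φ = φ ∷ properSubformulas φ
  properSubformulas (atom _)   = []
  properSubformulas (natom _)  = []
  properSubformulas (φ ∨ᶠ ψ)   = subformulas φ ++ subformulas ψ
  properSubformulas (φ ∧ᶠ ψ)   = subformulas φ ++ subformulas ψ
  properSubformulas (□ᶠ φ)     = subformulas φ
  properSubformulas (◇ᶠ φ)     = subformulas φ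
  properSubformulas ([ i ]ᶠ φ) = subformulas φ
  properSubformulas (⟨ i ⟩ᶠ φ) = subformulas φ
  properSubformulas (⊗ᶠ i φ)   = subformulas φ
  properSubformulas (⊖ᶠ i φ)   = subformulas φ

  ◁⇒proper : ∀ {φ ψ} → φ ◁ ψ → φ ∈ properSubformulas ψ
  ◁⇒proper ∨ˡ = here refl
  ◁⇒proper (∨ʳ {φ}) = ∈-++⁺ʳ (subformulas φ) (here refl)
  ◁⇒proper ∧ˡ = here refl
  ◁⇒proper (∧ʳ {φ}) = ∈-++⁺ʳ (subformulas φ) (here refl)
  ◁⇒proper □◁ = here refl
  ◁⇒proper ◇◁ = here refl
  ◁⇒proper []◁ = here refl
  ◁⇒proper ⟨⟩◁ = here refl
  ◁⇒proper ⊗◁ = here refl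
  ◁⇒proper ⊖◁ = here refl

  subformulas-closed : ∀ χ {φ ψ} → φ ∈ subformulas χ → ψ ◁ φ → ψ ∈ subformulas χ
  properSubformulas-closed : ∀ χ {φ ψ} → φ ∈ properSubformulas χ → ψ ◁ φ → ψ ∈ properSubformulas χ
  ++-closed : ∀ χ χ′ {φ ψ} → φ ∈ subformulas χ ++ subformulas χ′ → ψ ◁ φ → ψ ∈ subformulas χ ++ subformulas χ′
  subformulas-closed χ (here refl) s = there (◁⇒proper s)
  subformulas-closed χ (there p)   s = there (properSubformulas-closed χ p s)
  properSubformulas-closed (χ ∨ᶠ χ′)  = ++-closed χ χ′
  properSubformulas-closed (χ ∧ᶠ χ′)  = ++-closed χ χ′
  properSubformulas-closed (□ᶠ χ)     = subformulas-closed χ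
  properSubformulas-closed (◇ᶠ χ)     = subformulas-closed χ
  properSubformulas-closed ([ i ]ᶠ χ) = subformulas-closed χ
  properSubformulas-closed (⟨ i ⟩ᶠ χ) = subformulas-closed χ
  properSubformulas-closed (⊗ᶠ i χ)   = subformulas-closed χ
  properSubformulas-closed (⊖ᶠ i χ)   = subformulas-closed χ
  ++-closed χ χ′ p s with ∈-++⁻ (subformulas χ) p
  ... | inj₁ q = ∈-++⁺ˡ (subformulas-closed χ q s)
  ... | inj₂ q = ∈-++⁺ʳ (subformulas χ) (subformulas-closed χ′ q s)

  -- Only ⊗ and ⊖ are counted: they are the modalities that can leave a □-cluster.
  depth : Fm n → ℕ
  depth (atom _)   = 0
  depth (natom _)  = 0
  depth (φ ∨ᶠ ψ)   = depth φ ⊔ depth ψ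
  depth (φ ∧ᶠ ψ)   = depth φ ⊔ depth ψ
  depth (□ᶠ φ)     = depth φ
  depth (◇ᶠ φ)     = depth φ
  depth ([ _ ]ᶠ φ) = depth φ
  depth (⟨ _ ⟩ᶠ φ) = depth φ
  depth (⊗ᶠ _ φ)   = suc (depth φ)
  depth (⊖ᶠ _ φ)   = suc (depth φ)

-- Paths

module _ {n : ℕ} {R : List (RAtom n)} where

  ∼◇-trans : ∀ {x y z} → x ∼◇[ R ] y → y ∼◇[ R ] z → x ∼◇[ R ] z
  ∼◇-trans ◇refl        q = q
  ∼◇-trans (◇fwd□ e p)  q = ◇fwd□ e (∼◇-trans p q)
  ∼◇-trans (◇bwd□ e p)  q = ◇bwd□ e (∼◇-trans p q)
  ∼◇-trans (◇fwd[] e p) q = ◇fwd[] e (∼◇-trans p q)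
  ∼◇-trans (◇bwd[] e p) q = ◇bwd[] e (∼◇-trans p q)

  ∼◇-sym : ∀ {x y} → x ∼◇[ R ] y → y ∼◇[ R ] x
  ∼◇-sym ◇refl        = ◇refl
  ∼◇-sym (◇fwd□ e p)  = ∼◇-trans (∼◇-sym p) (◇bwd□ e ◇refl)
  ∼◇-sym (◇bwd□ e p)  = ∼◇-trans (∼◇-sym p) (◇fwd□ e ◇refl)
  ∼◇-sym (◇fwd[] e p) = ∼◇-trans (∼◇-sym p) (◇bwd[] e ◇refl)
  ∼◇-sym (◇bwd[] e p) = ∼◇-trans (∼◇-sym p) (◇fwd[] e ◇refl)

  ∼-trans : ∀ {i x y z} → x ∼[ i ∣ R ] y → y ∼[ i ∣ R ] z → x ∼[ i ∣ R ] z
  ∼-trans ∼refl      q = q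
  ∼-trans (∼fwd e p) q = ∼fwd e (∼-trans p q)
  ∼-trans (∼bwd e p) q = ∼bwd e (∼-trans p q)

  ∼-sym : ∀ {i x y} → x ∼[ i ∣ R ] y → y ∼[ i ∣ R ] x
  ∼-sym ∼refl      = ∼refl
  ∼-sym (∼fwd e p) = ∼-trans (∼-sym p) (∼bwd e ∼refl)
  ∼-sym (∼bwd e p) = ∼-trans (∼-sym p) (∼fwd e ∼refl)

  ∼⇒∼◇ : ∀ {i x y} → x ∼[ i ∣ R ] y → x ∼◇[ R ] y
  ∼⇒∼◇ ∼refl      = ◇refl
  ∼⇒∼◇ (∼fwd e p) = ◇fwd[] e (∼⇒∼◇ p)
  ∼⇒∼◇ (∼bwd e p) = ◇bwd[] e (∼⇒∼◇ p)

module _ {n : ℕ} {R R′ : List (RAtom n)} (R⊆R′ : R ⊆ R′) where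

  ∼◇-mono : ∀ {x y} → x ∼◇[ R ] y → x ∼◇[ R′ ] y
  ∼◇-mono ◇refl        = ◇refl
  ∼◇-mono (◇fwd□ e p)  = ◇fwd□ (R⊆R′ e) (∼◇-mono p)
  ∼◇-mono (◇bwd□ e p)  = ◇bwd□ (R⊆R′ e) (∼◇-mono p)
  ∼◇-mono (◇fwd[] e p) = ◇fwd[] (R⊆R′ e) (∼◇-mono p)
  ∼◇-mono (◇bwd[] e p) = ◇bwd[] (R⊆R′ e) (∼◇-mono p)

  ∼-mono : ∀ {i x y} → x ∼[ i ∣ R ] y → x ∼[ i ∣ R′ ] y
  ∼-mono ∼refl      = ∼refl
  ∼-mono (∼fwd e p) = ∼fwd (R⊆R′ e) (∼-mono p)
  ∼-mono (∼bwd e p) = ∼bwd (R⊆R′ e) (∼-mono p)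

module Completeness (m : ℕ) (X : Ext) (R₀ : List (RAtom (suc m))) (Γ₀ : List (LFm (suc m))) where

  n : ℕ
  n = suc m

  labelsOf : RAtom n → List Label
  labelsOf (R□ x y)    = x ∷ y ∷ []
  labelsOf (R[] _ x y) = x ∷ y ∷ []
  labelsOf (R⊗ _ x y)  = x ∷ y ∷ []

  -- The extra 0 only makes the list nonempty.
  Roots : List Label
  Roots = 0 ∷ concat (map labelsOf R₀) ++ map LFm.lab Γ₀

  Cl : List (Fm n)
  Cl = concat (map (subformulas ∘ LFm.fm) Γ₀)

  ∈-Cl : ∀ {x φ} → (x ∶ φ) ∈ Γ₀ → φ ∈ Cl
  ∈-Cl p = ∈-concat⁺′ (here refl) (∈-map⁺ (subformulas ∘ LFm.fm) p)

  Cl-closed : ∀ {φ ψ} → ψ ∈ Cl → φ ◁ ψ → φ ∈ Cl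
  Cl-closed p s = go Γ₀ p
    where
    go : ∀ Γ → _ ∈ concat (map (subformulas ∘ LFm.fm) Γ) → _ ∈ concat (map (subformulas ∘ LFm.fm) Γ)
    go (A ∷ Γ) q with ∈-++⁻ (subformulas (LFm.fm A)) q
    ... | inj₁ r = ∈-++⁺ˡ (subformulas-closed (LFm.fm A) r s)
    ... | inj₂ r = ∈-++⁺ʳ (subformulas (LFm.fm A)) (go Γ r)

  -- The sum is a crude bound for the largest depth. The successor makes
  -- `depth φ + level x < maxLevel` true at the roots; as an invariant it leaves no formula at
  -- labels of level `maxLevel`, where (D2) and (D5) stop creating successors.
  maxLevel : ℕ
  maxLevel = suc (sum (map (depth ∘ LFm.fm) Γ₀))

  -- Names of labels

  -- (nothing , φ) is a witness for □ φ, and (just i , φ) one for [ i ] φ.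
  InnerKind : Set
  InnerKind = Maybe (Fin n) × Fm n

  -- (i , inj₁ φ) is a witness for ⊗ i φ; (i , inj₂ false) and (i , inj₂ true) are the
  -- successors provided by (D2) and (D5¹).
  OuterKind : Set
  OuterKind = Fin n × (Fm n ⊎ Bool)

  data Name : Set where
    root : Label → Name
    inn  : InnerKind → Name → Name
    out  : OuterKind → Name → Name
    ioa  : Vec Name n → Name

  _≟ⁱ_ : DecidableEquality InnerKind
  _≟ⁱ_ = ×ₚ.≡-dec (Maybeₚ.≡-dec Finₚ._≟_) _≟ᶠ_

  _≟ᵒ_ : DecidableEquality OuterKind
  _≟ᵒ_ = ×ₚ.≡-dec Finₚ._≟_ (⊎ₚ.≡-dec _≟ᶠ_ Boolₚ._≟_)

  _≟_ : DecidableEquality Name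
  _≟ᵛ_ : ∀ {k} → DecidableEquality (Vec Name k)
  root r  ≟ root r′  = map′ (cong root) (λ { refl → refl }) (r ℕₚ.≟ r′)
  inn k x ≟ inn k′ x′ = map′ (λ { (refl , refl) → refl }) (λ { refl → refl , refl }) (k ≟ⁱ k′ ×-dec x ≟ x′)
  out k x ≟ out k′ x′ = map′ (λ { (refl , refl) → refl }) (λ { refl → refl , refl }) (k ≟ᵒ k′ ×-dec x ≟ x′)
  ioa xs  ≟ ioa xs′  = map′ (cong ioa) (λ { refl → refl }) (xs ≟ᵛ xs′)
  root _  ≟ inn _ _  = no λ ()
  root _  ≟ out _ _  = no λ ()
  root _  ≟ ioa _    = no λ ()
  inn _ _ ≟ root _   = no λ ()
  inn _ _ ≟ out _ _  = no λ ()
  inn _ _ ≟ ioa _    = no λ ()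
  out _ _ ≟ root _   = no λ ()
  out _ _ ≟ inn _ _  = no λ ()
  out _ _ ≟ ioa _    = no λ ()
  ioa _   ≟ root _   = no λ ()
  ioa _   ≟ inn _ _  = no λ ()
  ioa _   ≟ out _ _  = no λ ()
  []       ≟ᵛ []       = yes refl
  (x ∷ xs) ≟ᵛ (y ∷ ys) = map′ (λ { (refl , refl) → refl }) (λ { refl → refl , refl }) (x ≟ y ×-dec xs ≟ᵛ ys)

  Key : Set
  Key = Maybe (OuterKind × Name)

  _≟ᵏ_ : DecidableEquality Key
  _≟ᵏ_ = Maybeₚ.≡-dec (×ₚ.≡-dec _≟ᵒ_ _≟_)

  private
    outOrigin : Bool → Label ⊎ (OuterKind × Name) → OuterKind × Name → Label ⊎ (OuterKind × Name)
    outOrigin true  o _ = o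
    outOrigin false _ z = inj₂ z

    outLevel outRank : Bool → ℕ → ℕ
    outLevel true  l = l
    outLevel false l = suc l
    outRank true  r = suc r
    outRank false _ = 0

  -- The first name of the □-cluster in which a name was created: a root, or a name out k p.
  origin : Name → Label ⊎ (OuterKind × Name)
  origin (root r)       = inj₁ r
  origin (inn _ x)      = origin x
  origin (out k x)      = outOrigin (d3 X) (origin x) (k , x)
  origin (ioa (x ∷ _))  = origin x

  base : Name → Name
  base x = [ root , (λ (k , p) → out k p) ]′ (origin x)

  -- Root clusters may still be merged during the search, so they all share the key nothing.
  key : Name → Key
  key x = [ (λ _ → nothing) , just ]′ (origin x)

  parentKey : Key → Key
  parentKey nothing        = nothing
  parentKey (just (_ , p)) = key p

  -- The number of clusters above a name, and its distance from the origin inside its own cluster.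
  level : Name → ℕ
  level (root _)      = 0
  level (inn _ x)     = level x
  level (out _ x)     = outLevel (d3 X) (level x)
  level (ioa (x ∷ _)) = level x

  rank : Name → ℕ
  maxRank : ∀ {k} → Vec Name k → ℕ
  rank (root _)  = 0
  rank (inn _ x) = suc (rank x)
  rank (out _ x) = outRank (d3 X) (rank x)
  rank (ioa xs)  = suc (maxRank xs)
  maxRank []       = 0
  maxRank (x ∷ xs) = rank x ⊔ maxRank xs

  rank≤maxRank : ∀ {k} (xs : Vec Name k) j → rank (lookup xs j) ≤ maxRank xs
  rank≤maxRank (x ∷ xs) zero    = m≤m⊔n _ _
  rank≤maxRank (x ∷ xs) (suc j) = ≤-trans (rank≤maxRank xs j) (m≤n⊔m (rank x) _)

  maxRank≤ : ∀ {k b} (xs : Vec Name k) → (∀ j → rank (lookup xs j) ≤ b) → maxRank xs ≤ b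
  maxRank≤ []       h = z≤n
  maxRank≤ (x ∷ xs) h = ℕₚ.⊔-lub (h zero) (maxRank≤ xs (h ∘ suc))

  maxRank< : ∀ {k b} (xs : Vec Name (suc k)) → (∀ j → rank (lookup xs j) < b) → maxRank xs < b
  maxRank< {b = zero}  xs h = case h zero of λ ()
  maxRank< {b = suc b} xs h = s≤s (maxRank≤ xs λ j → ℕₚ.≤-pred (h j))

  record Staying (k : OuterKind) (x : Name) : Set where
    field
      isD3    : T (d3 X)
      origin≡ : origin (out k x) ≡ origin x
      level≡  : level (out k x) ≡ level x
      rank≡   : rank (out k x) ≡ suc (rank x)

  record Leaving (k : OuterKind) (x : Name) : Set where
    field
      notD3   : ¬ T (d3 X)
      origin≡ : origin (out k x) ≡ inj₂ (k , x)
      level≡  : level (out k x) ≡ suc (level x)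
      rank≡   : rank (out k x) ≡ 0

  -- `d3 X` is a parameter, so origin, level and rank of an outer name do not compute. The case
  -- distinction is made once here and passed on as equations.
  staying⊎leaving : ∀ k x → Staying k x ⊎ Leaving k x
  staying⊎leaving k x = go (d3 X) refl
    where
    go : ∀ b → d3 X ≡ b → Staying k x ⊎ Leaving k x
    go true  eq = inj₁ record
      { isD3 = subst T (sym eq) tt ; origin≡ = cong (λ b → outOrigin b (origin x) (k , x)) eq
      ; level≡ = cong (λ b → outLevel b (level x)) eq ; rank≡ = cong (λ b → outRank b (rank x)) eq }
    go false eq = inj₂ record
      { notD3 = subst T eq ; origin≡ = cong (λ b → outOrigin b (origin x) (k , x)) eq
      ; level≡ = cong (λ b → outLevel b (level x)) eq ; rank≡ = cong (λ b → outRank b (rank x)) eq }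

  origin⇒key : ∀ {x o} → origin x ≡ o → key x ≡ [ (λ _ → nothing) , just ]′ o
  origin⇒key = cong [ (λ _ → nothing) , just ]′

  key≡nothing : ∀ x → key x ≡ nothing → ∃ λ r → origin x ≡ inj₁ r
  key≡nothing x eq with origin x
  ... | inj₁ r = r , refl

  key≡just : ∀ x {z} → key x ≡ just z → origin x ≡ inj₂ z
  key≡just x eq with origin x
  key≡just x refl | inj₂ z = refl

  level-key : ∀ x → level x ≡ [ (λ _ → 0) , (λ (_ , p) → suc (level p)) ]′ (origin x)
  level-key (root _)      = refl
  level-key (inn _ x)     = level-key x
  level-key (ioa (x ∷ _)) = level-key x
  level-key (out k x) with staying⊎leaving k x
  ... | inj₁ s = let open Staying s in
    trans level≡ (trans (level-key x) (cong [ (λ _ → 0) , (λ (_ , p) → suc (level p)) ]′ (sym origin≡)))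
  ... | inj₂ s = let open Leaving s in
    trans level≡ (cong [ (λ _ → 0) , (λ (_ , p) → suc (level p)) ]′ (sym origin≡))

  -- □-paths are known to preserve keys only; this carries the depth bound of a formula along them.
  key-level : ∀ {x y} → key x ≡ key y → level x ≡ level y
  key-level {x} {y} eq = trans (level-key x) (trans (go (origin x) (origin y) eq) (sym (level-key y)))
    where
    go : ∀ o o′ → [ (λ _ → nothing) , just ]′ o ≡ [ (λ _ → nothing) , just ]′ o′ →
         [ (λ _ → 0) , (λ (_ , p) → suc (level p)) ]′ o ≡ [ (λ _ → 0) , (λ (_ , p) → suc (level p)) ]′ o′
    go (inj₁ _) (inj₁ _) eq   = refl
    go (inj₂ _) (inj₂ _) refl = refl

  -- An inequality, because `nothing` is its own parent: an ⊗-edge between root clusters stays on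
  -- level 0.
  parentKey-level : ∀ {x y} → key x ≡ parentKey (key y) → level y ≤ suc (level x)
  parentKey-level {x} {y} eq with origin y | level-key y
  ... | inj₁ _       | eq′ = ≤-trans (≤-reflexive eq′) z≤n
  ... | inj₂ (_ , p) | eq′ = ≤-reflexive (trans eq′ (cong suc (key-level {p} {x} (sym eq))))

  -- Under (D3) no outer successor leaves its cluster, so every name keeps a root as its origin.
  d3⇒key≡nothing : T (d3 X) → ∀ x → key x ≡ nothing
  d3⇒key≡nothing d (root _)      = refl
  d3⇒key≡nothing d (inn _ x)     = d3⇒key≡nothing d x
  d3⇒key≡nothing d (ioa (x ∷ _)) = d3⇒key≡nothing d x
  d3⇒key≡nothing d (out k x) with staying⊎leaving k x
  ... | inj₁ s = trans (origin⇒key {out k x} (Staying.origin≡ s)) (d3⇒key≡nothing d x)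
  ... | inj₂ s = contradiction d (Leaving.notD3 s)

  -- Facts

  Fact : Set
  Fact = Name ⊎ (Name × Fm n) ⊎ (Name × Name) ⊎ (Fin n × Name × Name) ⊎ (Fin n × Name × Name)
         ⊎ (Fin n × Name × Name) ⊎ (Fin n × Fm n × Name)

  -- Live x: x has been introduced.  Fml x φ: x : φ has to be falsified.
  -- Box x y and Cell i x y: x and y lie in one □-class, in one [i]-class.  Ought i x y: R_⊗i x y.
  -- OughtCell i x y: the whole [i]-class of y consists of R_⊗i-successors of x.
  -- Dia i φ x: ⟨i⟩ φ has to be falsified somewhere in the [i]-class of x.
  pattern Live x          = inj₁ x
  pattern Fml x φ         = inj₂ (inj₁ (x , φ))
  pattern Box x y         = inj₂ (inj₂ (inj₁ (x , y)))
  pattern Cell i x y      = inj₂ (inj₂ (inj₂ (inj₁ (i , x , y))))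
  pattern Ought i x y     = inj₂ (inj₂ (inj₂ (inj₂ (inj₁ (i , x , y)))))
  pattern OughtCell i x y = inj₂ (inj₂ (inj₂ (inj₂ (inj₂ (inj₁ (i , x , y))))))
  pattern Dia i φ x       = inj₂ (inj₂ (inj₂ (inj₂ (inj₂ (inj₂ (i , φ , x))))))

  _≟ᶠᵃ_ : DecidableEquality Fact
  _≟ᶠᵃ_ = ⊎ₚ.≡-dec _≟_ (⊎ₚ.≡-dec (×ₚ.≡-dec _≟_ _≟ᶠ_) (⊎ₚ.≡-dec (×ₚ.≡-dec _≟_ _≟_)
            (⊎ₚ.≡-dec triple (⊎ₚ.≡-dec triple (⊎ₚ.≡-dec triple
            (×ₚ.≡-dec Finₚ._≟_ (×ₚ.≡-dec _≟ᶠ_ _≟_)))))))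
    where
    triple : DecidableEquality (Fin n × Name × Name)
    triple = ×ₚ.≡-dec Finₚ._≟_ (×ₚ.≡-dec _≟_ _≟_)

  open DecMembership _≟ᶠᵃ_ using (_∈?_)

  -- Under D1 an R_⊗i-edge into a cluster is determined by its source cluster.  The sources of a
  -- cluster with origin out k p all lie in the cluster of p; those of a root cluster have roots.
  source : Key → Label → Name
  source nothing        r = root r
  source (just (_ , p)) _ = p

  -- Each family serves one replacement by a label of the same type: formulas for truth, boxes to
  -- tell apart the root clusters sharing the key `nothing`, `Dia` and `OughtCell` for the enlarged
  -- [i]-classes, `Ought` for incoming edges. Below a non-root key `source` ignores `r`, which
  -- merely repeats a probe.
  probes : List (Name → Fact)
  probes = map (λ φ x → Fml x φ) Cl
        ++ map (λ r x → Box (root r) x) Roots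
        ++ cartesianProductWith (λ i φ x → Dia i φ x) (allFin n) Cl
        ++ cartesianProductWith (λ i r x → Ought i (source (key x) r) x) (allFin n) Roots
        ++ cartesianProductWith (λ i r x → OughtCell i (source (key x) r) x) (allFin n) Roots

  allTypes : List (List Bool)
  allTypes = bitLists (length probes)

  typeOf : List Fact → Name → List Bool
  typeOf S x = map (λ p → does (p x ∈? S)) probes

  typeOf∈allTypes : ∀ S x → typeOf S x ∈ allTypes
  typeOf∈allTypes S x = subst (λ k → typeOf S x ∈ bitLists k) (length-map _ probes) (∈-bitLists (typeOf S x))

  does-≡⇒ : ∀ {P Q : Set} (p? : Dec P) (q? : Dec Q) → does p? ≡ does q? → P → Q
  does-≡⇒ (yes _) (yes q) _  _ = q
  does-≡⇒ (no ¬p) _       _  p = contradiction p ¬p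

  typeOf-≡⇒ : ∀ {S x y p} → typeOf S x ≡ typeOf S y → p ∈ probes → p x ∈ S → p y ∈ S
  typeOf-≡⇒ {S} {x} {y} {p} eq i = does-≡⇒ (p x ∈? S) (p y ∈? S) (map-≡⇒∈-≡ eq i)

  Fml∈probes : ∀ {φ} → φ ∈ Cl → (λ x → Fml x φ) ∈ probes
  Fml∈probes p = ∈-++⁺ˡ (∈-map⁺ (λ φ x → Fml x φ) p)

  Box∈probes : ∀ {r} → r ∈ Roots → (λ x → Box (root r) x) ∈ probes
  Box∈probes p = ∈-++⁺ʳ (map (λ φ x → Fml x φ) Cl) (∈-++⁺ˡ (∈-map⁺ (λ r x → Box (root r) x) p))

  Dia∈probes : ∀ i {φ} → φ ∈ Cl → (λ x → Dia i φ x) ∈ probes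
  Dia∈probes i p = ∈-++⁺ʳ (map (λ φ x → Fml x φ) Cl) (∈-++⁺ʳ (map (λ r x → Box (root r) x) Roots)
    (∈-++⁺ˡ (∈-cartesianProductWith⁺ (λ i φ x → Dia i φ x) (∈-allFin i) p)))

  Ought∈probes : ∀ i {r} → r ∈ Roots → (λ x → Ought i (source (key x) r) x) ∈ probes
  Ought∈probes i p = ∈-++⁺ʳ (map (λ φ x → Fml x φ) Cl) (∈-++⁺ʳ (map (λ r x → Box (root r) x) Roots)
    (∈-++⁺ʳ (cartesianProductWith (λ i φ x → Dia i φ x) (allFin n) Cl)
    (∈-++⁺ˡ (∈-cartesianProductWith⁺ (λ i r x → Ought i (source (key x) r) x) (∈-allFin i) p))))

  OughtCell∈probes : ∀ i {r} → r ∈ Roots → (λ x → OughtCell i (source (key x) r) x) ∈ probes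
  OughtCell∈probes i p = ∈-++⁺ʳ (map (λ φ x → Fml x φ) Cl) (∈-++⁺ʳ (map (λ r x → Box (root r) x) Roots)
    (∈-++⁺ʳ (cartesianProductWith (λ i φ x → Dia i φ x) (allFin n) Cl)
    (∈-++⁺ʳ (cartesianProductWith (λ i r x → Ought i (source (key x) r) x) (allFin n) Roots)
    (∈-cartesianProductWith⁺ (λ i r x → OughtCell i (source (key x) r) x) (∈-allFin i) p))))

  -- The finite universe

  -- One more than the number of types, so that in every cluster two consecutive ranks
  -- below rankBound realise the same types.
  abstract

    rankBound : ℕ
    rankBound = suc (length allTypes)

    types<rankBound : length allTypes < rankBound
    types<rankBound = ≤-refl

  innerKinds : List InnerKind
  innerKinds = cartesianProduct (nothing ∷ map just (allFin n)) Cl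

  ∈-innerKinds : ∀ j {φ} → φ ∈ Cl → (j , φ) ∈ innerKinds
  ∈-innerKinds j = ∈-cartesianProduct⁺ (scope j)
    where
    scope : ∀ j → j ∈ nothing ∷ map just (allFin n)
    scope nothing  = here refl
    scope (just i) = there (∈-map⁺ just (∈-allFin i))

  outerKinds : List OuterKind
  outerKinds = cartesianProduct (allFin n) (Cl ⊎ᴸ (false ∷ true ∷ []))

  stage : ℕ → List Name
  stage zero    = map root Roots
  stage (suc t) = stage t ++ cartesianProductWith inn innerKinds (stage t)
               ++ cartesianProductWith out outerKinds (stage t) ++ map ioa (vecs (stage t) n)

  stage-mono : ∀ {s t} → s ≤ t → stage s ⊆ stage t
  stage-mono h = go (ℕₚ.≤⇒≤′ h)
    where
    open import Data.Nat using (_≤′_; ≤′-refl; ≤′-step)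
    go : ∀ {s t} → s ≤′ t → stage s ⊆ stage t
    go ≤′-refl     p = p
    go (≤′-step h) p = ∈-++⁺ˡ (go h p)

  inn∈stage : ∀ t {k x} → k ∈ innerKinds → x ∈ stage t → inn k x ∈ stage (suc t)
  inn∈stage t p q = ∈-++⁺ʳ (stage t) (∈-++⁺ˡ (∈-cartesianProductWith⁺ inn p q))

  out∈stage : ∀ t {k x} → k ∈ outerKinds → x ∈ stage t → out k x ∈ stage (suc t)
  out∈stage t p q = ∈-++⁺ʳ (stage t) (∈-++⁺ʳ (cartesianProductWith inn innerKinds (stage t))
    (∈-++⁺ˡ (∈-cartesianProductWith⁺ out p q)))

  ioa∈stage : ∀ t {xs} → (∀ j → lookup xs j ∈ stage t) → ioa xs ∈ stage (suc t)
  ioa∈stage t {xs} h = ∈-++⁺ʳ (stage t) (∈-++⁺ʳ (cartesianProductWith inn innerKinds (stage t))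
    (∈-++⁺ʳ (cartesianProductWith out outerKinds (stage t)) (∈-map⁺ ioa (∈-vecs xs h))))

  -- A name is built with at most `rankBound` steps inside each cluster and one more to enter the
  -- next level, whence the factor `suc rankBound`. Together with the bounds on rank and level this
  -- puts every bounded name into one fixed stage.
  record Bounded (x : Name) : Set where
    field
      ∈stage : x ∈ stage (level x * suc rankBound + rank x)
      rank≤  : rank x ≤ rankBound
      level≤ : level x ≤ maxLevel
      rooted : ∀ {r} → origin x ≡ inj₁ r → r ∈ Roots

  abstract

    names : List Name
    names = stage (maxLevel * suc rankBound + rankBound)

    Bounded⇒∈names : ∀ {x} → Bounded x → x ∈ names
    Bounded⇒∈names b = stage-mono (ℕₚ.+-mono-≤ (ℕₚ.*-monoˡ-≤ (suc rankBound) level≤) rank≤) ∈stage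
      where open Bounded b

  root-bounded : ∀ {r} → r ∈ Roots → Bounded (root r)
  root-bounded p = record { ∈stage = ∈-map⁺ root p ; rank≤ = z≤n ; level≤ = z≤n ; rooted = λ { refl → p } }

  inn-bounded : ∀ {k x} → k ∈ innerKinds → rank x < rankBound → Bounded x → Bounded (inn k x)
  inn-bounded {k} {x} p h b = record
    { ∈stage = subst (λ t → inn k x ∈ stage t) (sym (ℕₚ.+-suc (level x * suc rankBound) (rank x))) (inn∈stage (level x * suc rankBound + rank x) p ∈stage)
    ; rank≤ = h ; level≤ = level≤ ; rooted = rooted }
    where open Bounded b

  out-bounded : ∀ {k x} → k ∈ outerKinds → rank x < rankBound → level x < maxLevel → Bounded x → Bounded (out k x)
  out-bounded {k} {x} p hr hl b with staying⊎leaving k x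
  ... | inj₁ s = record
    { ∈stage = stage-mono (≤-reflexive (trans (sym (ℕₚ.+-suc (level x * suc rankBound) (rank x)))
                 (cong₂ (λ l r → l * suc rankBound + r) (sym (Staying.level≡ s)) (sym (Staying.rank≡ s)))))
                 (out∈stage (level x * suc rankBound + rank x) p ∈stage)
    ; rank≤ = subst (_≤ rankBound) (sym (Staying.rank≡ s)) hr
    ; level≤ = subst (_≤ maxLevel) (sym (Staying.level≡ s)) level≤
    ; rooted = λ eq → rooted (trans (sym (Staying.origin≡ s)) eq) }
    where open Bounded b
  ... | inj₂ s = record
    { ∈stage = stage-mono (≤-trans (s≤s (≤-trans (+-monoʳ-≤ (level x * suc rankBound) rank≤)
                   (≤-reflexive (ℕₚ.+-comm (level x * suc rankBound) rankBound))))
                 (≤-trans (m≤m+n _ 0) (≤-reflexive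
                   (cong₂ (λ l r → l * suc rankBound + r) (sym (Leaving.level≡ s)) (sym (Leaving.rank≡ s))))))
                 (out∈stage (level x * suc rankBound + rank x) p ∈stage)
    ; rank≤ = subst (_≤ rankBound) (sym (Leaving.rank≡ s)) z≤n
    ; level≤ = subst (_≤ maxLevel) (sym (Leaving.level≡ s)) hl
    ; rooted = λ eq → case trans (sym (Leaving.origin≡ s)) eq of λ () }
    where open Bounded b

  ioa-bounded : ∀ {xs} → (∀ j → rank (lookup xs j) < rankBound) → (∀ j → key (lookup xs j) ≡ key (ioa xs)) →
                (∀ j → Bounded (lookup xs j)) → Bounded (ioa xs)
  ioa-bounded {xs@(x ∷ _)} hr hk b = record
    { ∈stage = subst (λ t → ioa xs ∈ stage t) (sym (ℕₚ.+-suc (level x * suc rankBound) (maxRank xs)))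
        (ioa∈stage (level x * suc rankBound + maxRank xs) λ j → stage-mono (ℕₚ.+-mono-≤
           (≤-reflexive (cong (_* suc rankBound) (key-level {lookup xs j} {x} (hk j)))) (rank≤maxRank xs j))
           (Bounded.∈stage (b j)))
    ; rank≤ = maxRank< xs hr
    ; level≤ = Bounded.level≤ (b zero) ; rooted = Bounded.rooted (b zero) }

  -- Coding names as labels

  position : Name → List Name → ℕ
  position x []       = 0
  position x (y ∷ ys) = if does (x ≟ y) then 0 else suc (position x ys)

  position-injective : ∀ {x y xs} → x ∈ xs → y ∈ xs → position x xs ≡ position y xs → x ≡ y
  position-injective {x} {y} {z ∷ _} p q eq with x ≟ z | y ≟ z
  ... | yes refl | yes refl = refl
  position-injective (here refl) q           eq | no ≢z | no _  = contradiction refl ≢z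
  position-injective (there p)   (here refl) eq | no _  | no ≢z = contradiction refl ≢z
  position-injective (there p)   (there q)   eq | no _  | no _  = position-injective p q (ℕₚ.suc-injective eq)

  -- Roots must keep the labels of the given sequent. All other names are coded above `sum Roots`,
  -- which dominates every root. Injectivity holds for bounded names only, since `position` does not
  -- separate names outside the list.
  code : Name → Label
  code (root r) = r
  code x        = suc (sum Roots + position x names)

  code-injective : ∀ {x y} → Bounded x → Bounded y → code x ≡ code y → x ≡ y
  code-injective {x} {y} bx by = go x y (Bounded⇒∈names bx) (Bounded⇒∈names by) (Bounded.rooted bx) (Bounded.rooted by)
    where
    root≢ : ∀ {r k} → r ∈ Roots → r ≢ suc (sum Roots + k)
    root≢ {k = k} p refl = ℕₚ.<-irrefl refl (≤-trans (s≤s (m≤m+n (sum Roots) k)) (∈⇒≤sum p))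
    same : ∀ {x y} → x ∈ names → y ∈ names → suc (sum Roots + position x names) ≡ suc (sum Roots + position y names) → x ≡ y
    same p q eq = position-injective p q (ℕₚ.+-cancelˡ-≡ (sum Roots) _ _ (ℕₚ.suc-injective eq))
    go : ∀ x y → x ∈ names → y ∈ names → (∀ {r} → origin x ≡ inj₁ r → r ∈ Roots) →
         (∀ {r} → origin y ≡ inj₁ r → r ∈ Roots) → code x ≡ code y → x ≡ y
    go (root _)  (root _)  p q f g eq = cong root eq
    go (root _)  (inn _ _) p q f g eq = contradiction eq (root≢ (f refl))
    go (root _)  (out _ _) p q f g eq = contradiction eq (root≢ (f refl))
    go (root _)  (ioa _)   p q f g eq = contradiction eq (root≢ (f refl))
    go (inn _ _) (root _)  p q f g eq = contradiction (sym eq) (root≢ (g refl))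
    go (out _ _) (root _)  p q f g eq = contradiction (sym eq) (root≢ (g refl))
    go (ioa _)   (root _)  p q f g eq = contradiction (sym eq) (root≢ (g refl))
    go (inn _ _) (inn _ _) p q f g eq = same p q eq
    go (inn _ _) (out _ _) p q f g eq = same p q eq
    go (inn _ _) (ioa _)   p q f g eq = same p q eq
    go (out _ _) (inn _ _) p q f g eq = same p q eq
    go (out _ _) (out _ _) p q f g eq = same p q eq
    go (out _ _) (ioa _)   p q f g eq = same p q eq
    go (ioa _)   (inn _ _) p q f g eq = same p q eq
    go (ioa _)   (out _ _) p q f g eq = same p q eq
    go (ioa _)   (ioa _)   p q f g eq = same p q eq

  triples : List (Fin n × Name × Name)
  triples = cartesianProduct (allFin n) (cartesianProduct names names)

  universe : List Fact
  universe = names ⊎ᴸ cartesianProduct names Cl ⊎ᴸ cartesianProduct names names ⊎ᴸ triples ⊎ᴸ triples ⊎ᴸ triples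
             ⊎ᴸ cartesianProduct (allFin n) (cartesianProduct Cl names)

  -- Search states

  record Config : Set where
    constructor config
    field
      rels  : List (RAtom n)
      fmls  : List (LFm n)
      hist  : D5Hist n
      facts : List Fact
  open Config

  Goal : Config → Set
  Goal c = Der X (hist c) (rels c) (fmls c)

  -- What remains of the principal formula once a rule that deletes it has been applied.
  Resolved : List Fact → Name → Fm n → Set
  Resolved S x (φ ∨ᶠ ψ)   = Fml x φ ∈ S × Fml x ψ ∈ S
  Resolved S x (φ ∧ᶠ ψ)   = Fml x φ ∈ S ⊎ Fml x ψ ∈ S
  Resolved S x (□ᶠ φ)     = Live (inn (nothing , φ) x) ∈ S
  Resolved S x ([ i ]ᶠ φ) = Live (inn (just i , φ) x) ∈ S
  Resolved S x (⊗ᶠ i φ)   = Live (out (i , inj₁ φ) x) ∈ S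
  Resolved S x _          = ⊥

  Resolved-mono : ∀ {S S′} → S ⊆ S′ → ∀ x φ → Resolved S x φ → Resolved S′ x φ
  Resolved-mono h x (φ ∨ᶠ ψ)   (p , q)  = h p , h q
  Resolved-mono h x (φ ∧ᶠ ψ)   (inj₁ p) = inj₁ (h p)
  Resolved-mono h x (φ ∧ᶠ ψ)   (inj₂ p) = inj₂ (h p)
  Resolved-mono h x (□ᶠ φ)     p        = h p
  Resolved-mono h x ([ i ]ᶠ φ) p        = h p
  Resolved-mono h x (⊗ᶠ i φ)   p        = h p

  -- What the rule that introduces a name guarantees about it. As part of the soundness of `Live`,
  -- it lets the countermodel read the witness property off the mere existence of the name.
  Made : List Fact → Name → Set
  Made S (root r)                     = ⊤
  Made S y@(inn (nothing , φ) x)      = Box x y ∈ S × Fml y φ ∈ S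
  Made S y@(inn (just i , φ) x)       = Cell i x y ∈ S × Fml y φ ∈ S
  Made S y@(out (i , inj₁ φ) x)       = Ought i x y ∈ S × Fml y φ ∈ S
  Made S y@(out (i , inj₂ false) x)   = Ought i x y ∈ S
  Made S y@(out (i , inj₂ true) x)    = OughtCell i x y ∈ S
  Made S y@(ioa xs)                   = ∀ j → Cell j (lookup xs j) y ∈ S

  Made-mono : ∀ {S S′} → S ⊆ S′ → ∀ y → Made S y → Made S′ y
  Made-mono h (root r)                   _       = tt
  Made-mono h (inn (nothing , φ) x)      (p , q) = h p , h q
  Made-mono h (inn (just i , φ) x)       (p , q) = h p , h q
  Made-mono h (out (i , inj₁ φ) x)       (p , q) = h p , h q
  Made-mono h (out (i , inj₂ false) x)   p       = h p
  Made-mono h (out (i , inj₂ true) x)    p       = h p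
  Made-mono h (ioa xs)                   p       = h ∘ p

  record LiveOK (c : Config) (y : Name) : Set where
    field
      bounded    : Bounded y
      base∼      : code (base y) ∼◇[ rels c ] code y
      liveBase   : Live (base y) ∈ facts c
      liveParent : ∀ {k p} → key y ≡ just (k , p) → Live p ∈ facts c
      made       : Made (facts c) y

  record FmlOK (c : Config) (x : Name) (φ : Fm n) : Set where
    field
      live  : Live x ∈ facts c
      ∈Cl   : φ ∈ Cl
      depth< : depth φ + level x < maxLevel
      -- For literals, `◇`, `⟨i⟩` and `⊖` the type `Resolved` is empty, so such formulas are still
      -- in the sequent.
      present⊎resolved : (code x ∶ φ) ∈ fmls c ⊎ Resolved (facts c) x φ

  record BoxOK (c : Config) (x y : Name) : Set where
    field
      liveˡ : Live x ∈ facts c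
      liveʳ : Live y ∈ facts c
      key≡  : key x ≡ key y
      path  : code x ∼◇[ rels c ] code y

  record CellOK (c : Config) (i : Fin n) (x y : Name) : Set where
    field
      liveˡ : Live x ∈ facts c
      liveʳ : Live y ∈ facts c
      key≡  : key x ≡ key y
      path  : code x ∼[ i ∣ rels c ] code y

  -- `link` is the converse of (D1) for clusters opened by the search: an edge into the cluster of
  -- `out k p` can only start in the □-class of `p`. This is why `source` may offer `p` alone.
  record EdgeOK (c : Config) (x y : Name) : Set where
    field
      liveˡ : Live x ∈ facts c
      liveʳ : Live y ∈ facts c
      key≡  : key x ≡ parentKey (key y)
      link  : ∀ {k p} → key y ≡ just (k , p) → code x ∼◇[ rels c ] code p

  -- The fact may have been moved by □-paths at its source and by [i]-paths at its target, while
  -- (D5²) needs the very pair recorded in the history and (D4) an atom present in the sequent. So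
  -- the original pair is remembered together with the paths.
  record CellSource (c : Config) (i : Fin n) (x y : Name) : Set where
    field
      src    : Name
      target : Label
      liveSrc : Live src ∈ facts c
      src∼   : code src ∼◇[ rels c ] code x
      target∼ : target ∼[ i ∣ rels c ] code y
      reason : (T (d5 X) × (i , code src , target) ∈ hist c) ⊎ (T (d4 X) × R⊗ i (code src) target ∈ rels c)

  -- The `⟨i⟩` formula stays at `src`; only the path grows, and the rule is applied from `src` to
  -- any label it reaches.
  record DiaOK (c : Config) (i : Fin n) (φ : Fm n) (x : Name) : Set where
    field
      live   : Live x ∈ facts c
      ∈Cl    : φ ∈ Cl
      depth< : depth φ + level x < maxLevel
      src    : Name
      liveSrc : Live src ∈ facts c
      present : (code src ∶ ⟨ i ⟩ᶠ φ) ∈ fmls c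
      path   : code src ∼[ i ∣ rels c ] code x

  Sound : Config → Fact → Set
  Sound c (Live x)          = LiveOK c x
  Sound c (Fml x φ)         = FmlOK c x φ
  Sound c (Box x y)         = BoxOK c x y
  Sound c (Cell i x y)      = CellOK c i x y
  Sound c (Ought i x y)     = EdgeOK c x y × R⊗ i (code x) (code y) ∈ rels c
  Sound c (OughtCell i x y) = EdgeOK c x y × CellSource c i x y
  Sound c (Dia i φ x)       = DiaOK c i φ x

  -- Formulas may vanish, but only once resolved. `keep` is restricted to live names because `code`
  -- separates only those.
  record _⊑_ (c c′ : Config) : Set where
    field
      rels⊆  : rels c ⊆ rels c′
      hist⊆  : hist c ⊆ hist c′
      facts⊆ : facts c ⊆ facts c′
      keep   : ∀ {x φ} → Live x ∈ facts c → (code x ∶ φ) ∈ fmls c → (code x ∶ φ) ∈ fmls c′ ⊎ Resolved (facts c′) x φ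

  module _ {c c′ : Config} (c⊑c′ : c ⊑ c′) where
    open _⊑_ c⊑c′

    private
      edge-mono : ∀ {x y} → EdgeOK c x y → EdgeOK c′ x y
      edge-mono e = record { liveˡ = facts⊆ liveˡ ; liveʳ = facts⊆ liveʳ ; key≡ = key≡ ; link = ∼◇-mono rels⊆ ∘ link }
        where open EdgeOK e

    Sound-mono : ∀ f → Sound c f → Sound c′ f
    Sound-mono (Live x) s = record
      { bounded = bounded ; base∼ = ∼◇-mono rels⊆ base∼ ; liveBase = facts⊆ liveBase
      ; liveParent = facts⊆ ∘ liveParent ; made = Made-mono facts⊆ x made }
      where open LiveOK s
    Sound-mono (Fml x φ) s = record
      { live = facts⊆ live ; ∈Cl = ∈Cl ; depth< = depth<
      ; present⊎resolved = [ keep live , inj₂ ∘ Resolved-mono facts⊆ x φ ]′ present⊎resolved }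
      where open FmlOK s
    Sound-mono (Box x y) s = record
      { liveˡ = facts⊆ liveˡ ; liveʳ = facts⊆ liveʳ ; key≡ = key≡ ; path = ∼◇-mono rels⊆ path }
      where open BoxOK s
    Sound-mono (Cell i x y) s = record
      { liveˡ = facts⊆ liveˡ ; liveʳ = facts⊆ liveʳ ; key≡ = key≡ ; path = ∼-mono rels⊆ path }
      where open CellOK s
    Sound-mono (Ought i x y) (e , p) = edge-mono e , rels⊆ p
    Sound-mono (OughtCell i x y) (e , s) = edge-mono e , record
      { src = src ; target = target ; liveSrc = facts⊆ liveSrc ; src∼ = ∼◇-mono rels⊆ src∼
      ; target∼ = ∼-mono rels⊆ target∼
      ; reason = [ inj₁ ∘ map₂ hist⊆ , inj₂ ∘ map₂ rels⊆ ]′ reason }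
      where open CellSource s
    Sound-mono (Dia i φ x) s = record
      { live = facts⊆ live ; ∈Cl = ∈Cl ; depth< = depth< ; src = src ; liveSrc = facts⊆ liveSrc
      ; present = [ id , (λ ()) ]′ (keep liveSrc present) ; path = ∼-mono rels⊆ path }
      where open DiaOK s

  LiveLabel : List Fact → Label → Set
  LiveLabel S l = ∃ λ x → Live x ∈ S × l ≡ code x

  -- Every label of the sequent codes a live name; with the injectivity of `code`, a name that is
  -- not yet live therefore has a fresh label.
  record State : Set where
    field
      conf  : Config
      sound : ∀ {f} → f ∈ facts conf → Sound conf f
      relsLive : ∀ {l} → Any (OccR l) (rels conf) → LiveLabel (facts conf) l
      fmlsLive : ∀ {A} → A ∈ fmls conf → LiveLabel (facts conf) (LFm.lab A)
  open State

  module _ (σ : State) where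

    private
      R = rels (conf σ)
      Γ = fmls (conf σ)
      H = hist (conf σ)
      S = facts (conf σ)

    bounded-live : ∀ {x} → Live x ∈ S → Bounded x
    bounded-live p = LiveOK.bounded (sound σ p)

    sound⇒∈universe : ∀ {f} → f ∈ S → f ∈ universe
    sound⇒∈universe {f} p = go f (sound σ p)
      where
      name : ∀ {x} → Live x ∈ S → x ∈ names
      name = Bounded⇒∈names ∘ bounded-live
      triple : ∀ i {x y} → Live x ∈ S → Live y ∈ S → (i , x , y) ∈ triples
      triple i p q = ∈-cartesianProduct⁺ (∈-allFin i) (∈-cartesianProduct⁺ (name p) (name q))
      go : ∀ f → Sound (conf σ) f → f ∈ universe
      go (Live x) s = ∈-⊎ᴸˡ (Bounded⇒∈names (LiveOK.bounded s))
      go (Fml x φ) s = ∈-⊎ᴸʳ (∈-⊎ᴸˡ (∈-cartesianProduct⁺ (name live) ∈Cl))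
        where open FmlOK s
      go (Box x y) s = ∈-⊎ᴸʳ (∈-⊎ᴸʳ (∈-⊎ᴸˡ (∈-cartesianProduct⁺ (name liveˡ) (name liveʳ))))
        where open BoxOK s
      go (Cell i x y) s = ∈-⊎ᴸʳ (∈-⊎ᴸʳ (∈-⊎ᴸʳ (∈-⊎ᴸˡ (triple i liveˡ liveʳ))))
        where open CellOK s
      go (Ought i x y) (s , _) = ∈-⊎ᴸʳ (∈-⊎ᴸʳ (∈-⊎ᴸʳ (∈-⊎ᴸʳ (∈-⊎ᴸˡ (triple i liveˡ liveʳ)))))
        where open EdgeOK s
      go (OughtCell i x y) (s , _) = ∈-⊎ᴸʳ (∈-⊎ᴸʳ (∈-⊎ᴸʳ (∈-⊎ᴸʳ (∈-⊎ᴸʳ (∈-⊎ᴸˡ (triple i liveˡ liveʳ))))))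
        where open EdgeOK s
      go (Dia i φ x) s = ∈-⊎ᴸʳ (∈-⊎ᴸʳ (∈-⊎ᴸʳ (∈-⊎ᴸʳ (∈-⊎ᴸʳ (∈-⊎ᴸʳ
        (∈-cartesianProduct⁺ (∈-allFin i) (∈-cartesianProduct⁺ ∈Cl (name live))))))))
        where open DiaOK s

    code-fresh : ∀ {y} → Bounded y → Live y ∉ S → Fresh (code y) R Γ
    code-fresh {y} b y∉ = (λ o → absurd (relsLive σ o)) , λ o → let _ , A∈ , eq = find o in
      absurd (subst (LiveLabel S) (sym eq) (fmlsLive σ A∈))
      where
      absurd : ¬ LiveLabel S (code y)
      absurd (x , x∈ , eq) = y∉ (subst (λ z → Live z ∈ S) (sym (code-injective b (bounded-live x∈) eq)) x∈)

    -- The recursion hypothesis of the search: one new fact is all that the well-founded induction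
    -- asks for.
    Progress : Set
    Progress = ∀ (σ′ : State) {f} → S ⊆ facts (conf σ′) → f ∈ facts (conf σ′) → f ∉ S → Goal (conf σ′)

    module _ (ih : Progress) where

      -- The common shape of a backward rule application. Soundness of the old facts follows by
      -- monotonicity, so only the new facts, the deleted formula and the new labels remain to be
      -- checked.
      extend : ∀ R⁺ Γ′ H⁺ S⁺ {f} → let c′ = config (R⁺ ++ R) Γ′ (H⁺ ++ H) (S⁺ ++ S) in
        (∀ {x φ} → Live x ∈ S → (code x ∶ φ) ∈ Γ → (code x ∶ φ) ∈ Γ′ ⊎ Resolved (S⁺ ++ S) x φ) →
        (conf σ ⊑ c′ → All (Sound c′) S⁺) →
        (∀ {l} → Any (OccR l) R⁺ → LiveLabel (S⁺ ++ S) l) →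
        (∀ {A} → A ∈ Γ′ → A ∈ Γ ⊎ LiveLabel (S⁺ ++ S) (LFm.lab A)) →
        f ∈ S⁺ → f ∉ S → Goal c′
      extend R⁺ Γ′ H⁺ S⁺ keep new occ⁺ occ′ f∈ f∉ = ih σ′ (∈-++⁺ʳ S⁺) (∈-++⁺ˡ f∈) f∉
        where
        c′ = config (R⁺ ++ R) Γ′ (H⁺ ++ H) (S⁺ ++ S)
        c⊑c′ : conf σ ⊑ c′
        c⊑c′ = record { rels⊆ = ∈-++⁺ʳ R⁺ ; hist⊆ = ∈-++⁺ʳ H⁺ ; facts⊆ = ∈-++⁺ʳ S⁺ ; keep = keep }
        old : ∀ {l} → LiveLabel S l → LiveLabel (S⁺ ++ S) l
        old (x , x∈ , eq) = x , ∈-++⁺ʳ S⁺ x∈ , eq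
        σ′ : State
        σ′ = record
          { conf = c′
          ; sound = λ {f} p → [ All.lookup (new c⊑c′) , (λ q → Sound-mono c⊑c′ f (sound σ q)) ]′ (∈-++⁻ S⁺ p)
          ; relsLive = λ o → [ occ⁺ , old ∘ relsLive σ ]′ (Anyₚ.++⁻ R⁺ o)
          ; fmlsLive = λ p → [ old ∘ fmlsLive σ , id ]′ (occ′ p) }

      addRels : ∀ R⁺ f → Sound (config (R⁺ ++ R) Γ H S) f → (∀ {l} → Any (OccR l) R⁺ → LiveLabel S l) →
                f ∉ S → Der X H (R⁺ ++ R) Γ
      addRels R⁺ f s occ f∉ = extend R⁺ Γ [] (f ∷ []) (λ _ → inj₁)
        (λ _ → Sound-mono (record { rels⊆ = id ; hist⊆ = id ; facts⊆ = there ; keep = λ _ → inj₁ }) f s ∷ [])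
        (map₂ (λ (p , eq) → there p , eq) ∘ occ) inj₁ (here refl) f∉

      -- No rule is applied: the fact already follows from the sequent, and recording it still
      -- decreases the measure.
      note : ∀ f → Sound (conf σ) f → f ∉ S → Goal (conf σ)
      note f s = addRels [] f s λ ()

      addFml : ∀ {y φ} → Live y ∈ S → φ ∈ Cl → depth φ + level y < maxLevel → Fml y φ ∉ S → Der X H R ((code y ∶ φ) ∷ Γ)
      addFml {y} {φ} y∈ φ∈ d = extend [] ((code y ∶ φ) ∷ Γ) [] (Fml y φ ∷ []) (λ _ → inj₁ ∘ there)
        (λ _ → record { live = there y∈ ; ∈Cl = φ∈ ; depth< = d ; present⊎resolved = inj₁ (here refl) } ∷ [])
        (λ ()) (λ { (here refl) → inj₂ (_ , there y∈ , refl) ; (there p) → inj₁ p }) (here refl)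

  -- The steps of the search

  Inner : Maybe (Fin n) → Name → Name → Fact
  Inner nothing  x y = Box x y
  Inner (just i) x y = Cell i x y

  innerAtom : Maybe (Fin n) → Label → Label → RAtom n
  innerAtom nothing  = R□
  innerAtom (just i) = R[] i

  necessarily : Maybe (Fin n) → Fm n → Fm n
  necessarily nothing  = □ᶠ
  necessarily (just i) = [ i ]ᶠ

  -- Under (D3) the □-atom is added together with the ⊗-atom, because soundness of the new name
  -- already demands a □-path from the base of its cluster.
  outerAtoms : Bool → Fin n → Label → Label → List (RAtom n)
  outerAtoms true  i x y = R□ x y ∷ R⊗ i x y ∷ []
  outerAtoms false i x y = R⊗ i x y ∷ []

  R⊗∈outerAtoms : ∀ b {i x y} → R⊗ i x y ∈ outerAtoms b i x y
  R⊗∈outerAtoms true  = there (here refl)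
  R⊗∈outerAtoms false = here refl

  R□∈outerAtoms : ∀ b {i x y} → T b → R□ x y ∈ outerAtoms b i x y
  R□∈outerAtoms true _ = here refl

  outerAtoms-occ : ∀ b {i x y l} → Any (OccR l) (outerAtoms b i x y) → l ≡ x ⊎ l ≡ y
  outerAtoms-occ true  (here o)         = o
  outerAtoms-occ true  (there (here o)) = o
  outerAtoms-occ false (here o)         = o

  outerAtoms-D3 : ∀ {H R Γ i x y} → Der X H (outerAtoms (d3 X) i x y ++ R) Γ → Der X H (R⊗ i x y ∷ R) Γ
  outerAtoms-D3 {H} {R} {Γ} {i} {x} {y} = go (d3 X) id
    where
    go : ∀ b → (T b → T (d3 X)) → Der X H (outerAtoms b i x y ++ R) Γ → Der X H (R⊗ i x y ∷ R) Γ
    go true  h d = D3 (h tt) (here refl) d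
    go false _ d = d

  level-out : ∀ k x → level (out k x) ≤ suc (level x)
  level-out k x with staying⊎leaving k x
  ... | inj₁ s = ≤-trans (≤-reflexive (Staying.level≡ s)) (ℕₚ.n≤1+n _)
  ... | inj₂ s = ≤-reflexive (Leaving.level≡ s)

  origin⇒base : ∀ {x o} → origin x ≡ o → base x ≡ [ root , (λ (k , p) → out k p) ]′ o
  origin⇒base = cong [ root , (λ (k , p) → out k p) ]′

  key-base : ∀ x → key (base x) ≡ key x
  key-base x = go (origin x) refl
    where
    go : ∀ o → origin x ≡ o → key (base x) ≡ key x
    go (inj₁ r) eq = trans (cong key (origin⇒base {x} eq)) (sym (origin⇒key {x} eq))
    go (inj₂ (k , p)) eq with staying⊎leaving k p
    ... | inj₁ s = case trans (sym (origin⇒key {x} eq)) (d3⇒key≡nothing (Staying.isD3 s) x) of λ ()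
    ... | inj₂ s = trans (cong key (origin⇒base {x} eq))
                     (trans (origin⇒key {out k p} (Leaving.origin≡ s)) (sym (origin⇒key {x} eq)))

  out-live : ∀ {c k x} → let y = out k x in
    LiveOK c x → Live x ∈ facts c → Live y ∈ facts c → (T (d3 X) → code x ∼◇[ rels c ] code y) →
    Bounded y → Made (facts c) y → LiveOK c y
  out-live {c} {k} {x} s x∈ y∈ path b made with staying⊎leaving k x
  ... | inj₁ t = record
    { bounded = b ; made = made
    ; base∼ = subst (λ z → code z ∼◇[ rels c ] code (out k x)) (sym base≡) (∼◇-trans base∼ (path isD3))
    ; liveBase = subst (λ z → Live z ∈ facts c) (sym base≡) liveBase
    ; liveParent = λ eq → case trans (sym eq) (d3⇒key≡nothing isD3 (out k x)) of λ () }
    where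
    open LiveOK s hiding (made)
    open Staying t
    base≡ : base (out k x) ≡ base x
    base≡ = origin⇒base {out k x} origin≡
  ... | inj₂ t = record
    { bounded = b ; made = made
    ; base∼ = subst (λ z → code z ∼◇[ rels c ] code (out k x)) (sym base≡) ◇refl
    ; liveBase = subst (λ z → Live z ∈ facts c) (sym base≡) y∈
    ; liveParent = λ eq → case trans (sym eq) (origin⇒key {out k x} origin≡) of λ { refl → x∈ } }
    where
    open Leaving t
    base≡ : base (out k x) ≡ out k x
    base≡ = origin⇒base {out k x} origin≡

  out-edge : ∀ {c k x} → Live x ∈ facts c → Live (out k x) ∈ facts c → EdgeOK c x (out k x)
  out-edge {c} {k} {x} x∈ y∈ with staying⊎leaving k x
  ... | inj₁ t = record
    { liveˡ = x∈ ; liveʳ = y∈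
    ; key≡ = trans (d3⇒key≡nothing isD3 x) (cong parentKey (sym (d3⇒key≡nothing isD3 (out k x))))
    ; link = λ eq → case trans (sym eq) (d3⇒key≡nothing isD3 (out k x)) of λ () }
    where open Staying t
  ... | inj₂ t = record
    { liveˡ = x∈ ; liveʳ = y∈
    ; key≡ = cong parentKey (sym (origin⇒key {out k x} origin≡))
    ; link = λ eq → case trans (sym eq) (origin⇒key {out k x} origin≡) of λ { refl → ◇refl } }
    where open Leaving t

  Tuple : List Fact → Vec Name n → Set
  Tuple S xs = (∀ j → Live (lookup xs j) ∈ S × rank (lookup xs j) < rankBound)
             × (∀ j k → Box (lookup xs j) (lookup xs k) ∈ S)

  module Steps (σ : State) (ih : Progress σ) where

    private
      c = conf σ
      R = rels c
      Γ = fmls c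
      H = hist c
      S = facts c

      -- A live name whose label is that of the deleted occurrence must be `x` itself, by
      -- injectivity of `code`, and there the formula is resolved.
      keep-rest : ∀ {x χ Γ′ Γ″ S′} → Γ ↭ (code x ∶ χ) ∷ Γ′ → Live x ∈ S → Resolved S′ x χ → Γ′ ⊆ Γ″ →
                  ∀ {y ψ} → Live y ∈ S → (code y ∶ ψ) ∈ Γ → (code y ∶ ψ) ∈ Γ″ ⊎ Resolved S′ y ψ
      keep-rest {x} {χ} {S′ = S′} perm x∈ r sub y∈ p with ∈-resp-↭ perm p
      ... | there q = inj₁ (sub q)
      ... | here eq = inj₂ (subst (λ z → Resolved S′ z _)
              (code-injective (bounded-live σ x∈) (bounded-live σ y∈) (sym (cong LFm.lab eq)))
              (subst (Resolved S′ x) (sym (cong LFm.fm eq)) r))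

      rest⊆ : ∀ {A Γ′} → Γ ↭ A ∷ Γ′ → Γ′ ⊆ Γ
      rest⊆ perm = ∈-resp-↭ (↭-sym perm) ∘ there

      new-fml : ∀ {c′ y φ} → Live y ∈ facts c′ → φ ∈ Cl → depth φ + level y < maxLevel → (code y ∶ φ) ∈ fmls c′ → FmlOK c′ y φ
      new-fml y∈ φ∈ d p = record { live = y∈ ; ∈Cl = φ∈ ; depth< = d ; present⊎resolved = inj₁ p }

    or-step : ∀ {x φ ψ f} → Fml x (φ ∨ᶠ ψ) ∈ S → f ∈ Fml x φ ∷ Fml x ψ ∷ [] → f ∉ S → Goal c
    or-step {x} {φ} {ψ} {f} p f∈ f∉ with FmlOK.present⊎resolved (sound σ p)
    ... | inj₂ (q , r) = contradiction (All.lookup {P = _∈ S} (q ∷ r ∷ []) f∈) f∉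
    ... | inj₁ q with Γ′ , perm ← extract q = ∨R perm
      (extend σ ih [] ((code x ∶ φ) ∷ (code x ∶ ψ) ∷ Γ′) [] (Fml x φ ∷ Fml x ψ ∷ [])
        (keep-rest {x = x} perm live (here refl , there (here refl)) (there ∘ there))
        (λ _ → new-fml (there (there live)) (Cl-closed ∈Cl ∨ˡ) (≤-trans (s≤s (+-monoˡ-≤ (level x) (m≤m⊔n (depth φ) (depth ψ)))) depth<) (here refl)
             ∷ new-fml (there (there live)) (Cl-closed ∈Cl ∨ʳ) (≤-trans (s≤s (+-monoˡ-≤ (level x) (m≤n⊔m (depth φ) (depth ψ)))) depth<) (there (here refl)) ∷ [])
        (λ ())
        (λ { (here refl) → inj₂ (x , there (there live) , refl)
           ; (there (here refl)) → inj₂ (x , there (there live) , refl)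
           ; (there (there r)) → inj₁ (rest⊆ perm r) })
        f∈ f∉)
      where open FmlOK (sound σ p)

    and-step : ∀ {x φ ψ} → Fml x (φ ∧ᶠ ψ) ∈ S → Fml x φ ∉ S → Fml x ψ ∉ S → Goal c
    and-step {x} {φ} {ψ} p φ∉ ψ∉ with FmlOK.present⊎resolved (sound σ p)
    ... | inj₂ (inj₁ q) = contradiction q φ∉
    ... | inj₂ (inj₂ q) = contradiction q ψ∉
    ... | inj₁ q with Γ′ , perm ← extract q = ∧R perm
        (branch perm inj₁ ∧ˡ (m≤m⊔n (depth φ) (depth ψ)) φ∉) (branch perm inj₂ ∧ʳ (m≤n⊔m (depth φ) (depth ψ)) ψ∉)
      where
      open FmlOK (sound σ p)
      branch : ∀ {Γ′ χ} → Γ ↭ (code x ∶ (φ ∧ᶠ ψ)) ∷ Γ′ → (∀ {S′} → Fml x χ ∈ S′ → Resolved S′ x (φ ∧ᶠ ψ)) →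
               χ ◁ (φ ∧ᶠ ψ) → depth χ ≤ depth φ ⊔ depth ψ → Fml x χ ∉ S → Der X H R ((code x ∶ χ) ∷ Γ′)
      branch {Γ′} {χ} perm res s le = extend σ ih [] ((code x ∶ χ) ∷ Γ′) [] (Fml x χ ∷ [])
        (keep-rest {x = x} perm live (res (here refl)) there)
        (λ _ → new-fml (there live) (Cl-closed ∈Cl s) (≤-trans (s≤s (+-monoˡ-≤ (level x) le)) depth<) (here refl) ∷ [])
        (λ ()) (λ { (here refl) → inj₂ (x , there live , refl) ; (there r) → inj₁ (rest⊆ perm r) }) (here refl)

    inner-step : ∀ {x φ} j → Fml x (necessarily j φ) ∈ S → rank x < rankBound → Live (inn (j , φ) x) ∉ S → Goal c
    inner-step {x} {φ} j p h y∉ = go j (FmlOK.present⊎resolved (sound σ p)) (LiveOK.bounded (sound σ live)) p y∉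
      where
      open FmlOK (sound σ p) using (live)
      premise : ∀ {Γ′} j → Live (inn (j , φ) x) ∉ S → Bounded (inn (j , φ) x) →
                (∀ {S′} → Live (inn (j , φ) x) ∈ S′ → Resolved S′ x (necessarily j φ)) →
                φ ∈ Cl → depth φ + level x < maxLevel →
                Γ ↭ (code x ∶ necessarily j φ) ∷ Γ′ →
                Der X H (innerAtom j (code x) (code (inn (j , φ) x)) ∷ R) ((code (inn (j , φ) x) ∶ φ) ∷ Γ′)
      premise {Γ′} j y∉ b res φ∈ d perm =
        extend σ ih (innerAtom j (code x) (code y) ∷ []) ((code y ∶ φ) ∷ Γ′) [] S⁺
          (keep-rest {x = x} perm live (res (here refl)) there)
          (λ c⊑ → let open LiveOK (Sound-mono c⊑ (Live x) (sound σ live)) in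
            record { bounded = b ; base∼ = ∼◇-trans base∼ (x∼y j) ; liveBase = liveBase ; liveParent = liveParent ; made = made′ j }
            ∷ inner j ∷ new-fml (here refl) φ∈ d (here refl) ∷ [])
          (λ { (here o) → occ j o })
          (λ { (here refl) → inj₂ (y , here refl , refl) ; (there r) → inj₁ (rest⊆ perm r) })
          (here refl) y∉
        where
        y  = inn (j , φ) x
        S⁺ = Live y ∷ Inner j x y ∷ Fml y φ ∷ []
        live⁺ : Live x ∈ S⁺ ++ S
        live⁺ = there (there (there live))
        x∼y : ∀ j′ → code x ∼◇[ innerAtom j′ (code x) (code y) ∷ R ] code y
        x∼y nothing  = ◇fwd□ (here refl) ◇refl
        x∼y (just i) = ◇fwd[] (here refl) ◇refl
        made′ : ∀ j′ → Made (Live (inn (j′ , φ) x) ∷ Inner j′ x (inn (j′ , φ) x) ∷ Fml (inn (j′ , φ) x) φ ∷ S) (inn (j′ , φ) x)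
        made′ nothing  = there (here refl) , there (there (here refl))
        made′ (just i) = there (here refl) , there (there (here refl))
        inner : ∀ j′ → Sound (config (innerAtom j′ (code x) (code y) ∷ R) ((code y ∶ φ) ∷ Γ′) H (S⁺ ++ S)) (Inner j′ x y)
        inner nothing  = record { liveˡ = live⁺ ; liveʳ = here refl ; key≡ = refl ; path = ◇fwd□ (here refl) ◇refl }
        inner (just i) = record { liveˡ = live⁺ ; liveʳ = here refl ; key≡ = refl ; path = ∼fwd (here refl) ∼refl }
        occ : ∀ j′ {l} → OccR l (innerAtom j′ (code x) (code y)) → LiveLabel (S⁺ ++ S) l
        occ nothing  (inj₁ eq) = x , live⁺ , eq
        occ nothing  (inj₂ eq) = y , here refl , eq
        occ (just i) (inj₁ eq) = x , live⁺ , eq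
        occ (just i) (inj₂ eq) = y , here refl , eq
      go : ∀ j → (code x ∶ necessarily j φ) ∈ Γ ⊎ Resolved S x (necessarily j φ) → Bounded x →
           Fml x (necessarily j φ) ∈ S → Live (inn (j , φ) x) ∉ S → Goal c
      go nothing  (inj₂ q) b p y∉ = contradiction q y∉
      go (just i) (inj₂ q) b p y∉ = contradiction q y∉
      go nothing (inj₁ q) b p y∉ with Γ′ , perm ← extract q = □R perm (code-fresh σ b′ y∉) (premise nothing y∉ b′ id φ∈ depth< perm)
        where
        open FmlOK (sound σ p)
        φ∈ = Cl-closed ∈Cl □◁
        b′ = inn-bounded (∈-innerKinds nothing φ∈) h b
      go (just i) (inj₁ q) b p y∉ with Γ′ , perm ← extract q = []R perm (code-fresh σ b′ y∉) (premise (just i) y∉ b′ id φ∈ depth< perm)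
        where
        open FmlOK (sound σ p)
        φ∈ = Cl-closed ∈Cl []◁
        b′ = inn-bounded (∈-innerKinds (just i) φ∈) h b

    module _ {i : Fin n} {x : Name} (x∈ : Live x ∈ S) (rank< : rank x < rankBound) (level< : level x < maxLevel) where

      private
        out-bounded′ : ∀ {q} → q ∈ (Cl ⊎ᴸ (false ∷ true ∷ [])) → Bounded (out (i , q) x)
        out-bounded′ q∈ = out-bounded (∈-cartesianProduct⁺ (∈-allFin i) q∈) rank< level< (bounded-live σ x∈)

        outer-premise : ∀ {q} Γ′ H⁺ S⁺ → let y = out (i , q) x in
          Bounded y →
          (∀ {z ψ} → Live z ∈ S → (code z ∶ ψ) ∈ Γ → (code z ∶ ψ) ∈ Γ′ ⊎ Resolved (Live y ∷ S⁺ ++ S) z ψ) →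
          Made (Live y ∷ S⁺ ++ S) y →
          (let c′ = config (outerAtoms (d3 X) i (code x) (code y) ++ R) Γ′ (H⁺ ++ H) (Live y ∷ S⁺ ++ S) in
             EdgeOK c′ x y → R⊗ i (code x) (code y) ∈ rels c′ → All (Sound c′) S⁺) →
          (∀ {A} → A ∈ Γ′ → A ∈ Γ ⊎ LiveLabel (Live y ∷ S⁺ ++ S) (LFm.lab A)) →
          Live y ∉ S → Der X (H⁺ ++ H) (R⊗ i (code x) (code y) ∷ R) Γ′
        outer-premise {q} Γ′ H⁺ S⁺ b keep made new occ y∉ = outerAtoms-D3
          (extend σ ih R⁺ Γ′ H⁺ (Live y ∷ S⁺) keep
            (λ c⊑ → out-live (Sound-mono c⊑ (Live x) (sound σ x∈)) x∈⁺ (here refl)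
                      (λ d → ◇fwd□ (∈-++⁺ˡ (R□∈outerAtoms (d3 X) d)) ◇refl) b made
                  ∷ new (out-edge x∈⁺ (here refl)) (∈-++⁺ˡ (R⊗∈outerAtoms (d3 X))))
            (λ o → [ (λ eq → x , x∈⁺ , eq) , (λ eq → y , here refl , eq) ]′ (outerAtoms-occ (d3 X) o))
            occ (here refl) y∉)
          where
          y = out (i , q) x
          R⁺ = outerAtoms (d3 X) i (code x) (code y)
          x∈⁺ : Live x ∈ Live y ∷ S⁺ ++ S
          x∈⁺ = there (∈-++⁺ʳ S⁺ x∈)

      ⊗-step : ∀ {φ} → Fml x (⊗ᶠ i φ) ∈ S → Live (out (i , inj₁ φ) x) ∉ S → Goal c
      ⊗-step {φ} p y∉ with FmlOK.present⊎resolved (sound σ p)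
      ... | inj₂ q = contradiction q y∉
      ... | inj₁ q with Γ′ , perm ← extract q = ⊗R perm (code-fresh σ b y∉)
        (outer-premise ((code y ∶ φ) ∷ Γ′) [] (Ought i x y ∷ Fml y φ ∷ []) b
          (keep-rest {x = x} perm x∈ (here refl) there)
          (there (here refl) , there (there (here refl)))
          (λ e r → (e , r) ∷ new-fml (here refl) φ∈
             (≤-trans (s≤s (≤-trans (+-monoʳ-≤ (depth φ) (level-out (i , inj₁ φ) x)) (≤-reflexive (ℕₚ.+-suc (depth φ) (level x))))) depth<)
             (here refl) ∷ [])
          (λ { (here refl) → inj₂ (y , here refl , refl) ; (there r) → inj₁ (rest⊆ perm r) }) y∉)
        where
        open FmlOK (sound σ p)
        y  = out (i , inj₁ φ) x
        φ∈ = Cl-closed ∈Cl ⊗◁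
        b  = out-bounded′ (∈-⊎ᴸˡ φ∈)

      D2-step : T (d2 X) → Live (out (i , inj₂ false) x) ∉ S → Goal c
      D2-step d y∉ = D2 {x = code x} d (code-fresh σ b y∉)
        (outer-premise Γ [] (Ought i x y ∷ []) b (λ _ → inj₁) (there (here refl))
          (λ e r → (e , r) ∷ []) inj₁ y∉)
        where
        y = out (i , inj₂ false) x
        b = out-bounded′ (∈-⊎ᴸʳ (here refl))

      D5-step : T (d5 X) → Live (out (i , inj₂ true) x) ∉ S → Goal c
      D5-step d y∉ = D5¹ {x = code x} d (code-fresh σ b y∉)
        (outer-premise Γ ((i , code x , code y) ∷ []) (OughtCell i x y ∷ []) b (λ _ → inj₁) (there (here refl))
          (λ e r → (e , record
            { src = x ; target = code y ; liveSrc = EdgeOK.liveˡ e ; src∼ = ◇refl ; target∼ = ∼refl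
            ; reason = inj₁ (d , here refl) }) ∷ []) inj₁ y∉)
        where
        y = out (i , inj₂ true) x
        b = out-bounded′ (∈-⊎ᴸʳ (there (here refl)))

    ioa-step : ∀ {xs} → Tuple S xs → Live (ioa xs) ∉ S → Goal c
    ioa-step {xs@(x ∷ _)} (live , boxed) y∉ = IOA (code ∘ lookup xs) (code-fresh σ b y∉)
      (λ j k _ → BoxOK.path (sound σ (boxed j k)))
      (extend σ ih R⁺ Γ [] (Live y ∷ A⁺) (λ _ → inj₁)
        (λ c⊑ → let open LiveOK (Sound-mono c⊑ (Live x) (sound σ (proj₁ (live zero)))) in
          record { bounded = b ; base∼ = ∼◇-trans base∼ (∼⇒∼◇ (path zero)) ; liveBase = liveBase ; liveParent = liveParent
                 ; made = λ j → there (∈-++⁺ˡ (∈-map⁺ (λ j → Cell j (lookup xs j) y) (∈-allFin j))) }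
          ∷ All.tabulate λ p → cell (∈-map⁻ (λ j → Cell j (lookup xs j) y) p))
        (λ o → occ (find (Anyₚ.map⁻ o)))
        inj₁ (here refl) y∉)
      where
      y  = ioa xs
      R⁺ = map (λ j → R[] j (code (lookup xs j)) (code y)) (allFin n)
      A⁺ = map (λ j → Cell j (lookup xs j) y) (allFin n)
      key≡ : ∀ j → key (lookup xs j) ≡ key y
      key≡ j = BoxOK.key≡ (sound σ (boxed j zero))
      b : Bounded y
      b = ioa-bounded (proj₂ ∘ live) key≡ (bounded-live σ ∘ proj₁ ∘ live)
      live⁺ : ∀ j → Live (lookup xs j) ∈ Live y ∷ A⁺ ++ S
      live⁺ j = there (∈-++⁺ʳ A⁺ (proj₁ (live j)))
      path : ∀ j → code (lookup xs j) ∼[ j ∣ R⁺ ++ R ] code y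
      path j = ∼fwd (∈-++⁺ˡ (∈-map⁺ (λ j → R[] j (code (lookup xs j)) (code y)) (∈-allFin j))) ∼refl
      cell : ∀ {f} → (∃ λ j → j ∈ allFin n × f ≡ Cell j (lookup xs j) y) → Sound (config (R⁺ ++ R) Γ H (Live y ∷ A⁺ ++ S)) f
      cell (j , _ , refl) = record { liveˡ = live⁺ j ; liveʳ = here refl ; key≡ = key≡ j ; path = path j }
      occ : ∀ {l} → (∃ λ j → j ∈ allFin n × OccR l (R[] j (code (lookup xs j)) (code y))) → LiveLabel (Live y ∷ A⁺ ++ S) l
      occ (j , _ , inj₁ eq) = lookup xs j , live⁺ j , eq
      occ (j , _ , inj₂ eq) = y , here refl , eq

  -- Closure conditions on sets of facts, and their finite enumeration

  data Rule₁ : Fact → Fact → Set where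
    ∨ˡ-rule    : ∀ {x φ ψ} → Rule₁ (Fml x (φ ∨ᶠ ψ)) (Fml x φ)
    ∨ʳ-rule    : ∀ {x φ ψ} → Rule₁ (Fml x (φ ∨ᶠ ψ)) (Fml x ψ)
    □-rule     : ∀ {x φ} → rank x < rankBound → Rule₁ (Fml x (□ᶠ φ)) (Live (inn (nothing , φ) x))
    []-rule    : ∀ {x i φ} → rank x < rankBound → Rule₁ (Fml x ([ i ]ᶠ φ)) (Live (inn (just i , φ) x))
    ⊗-rule     : ∀ {x i φ} → rank x < rankBound → Rule₁ (Fml x (⊗ᶠ i φ)) (Live (out (i , inj₁ φ) x))
    ⟨⟩-rule    : ∀ {x i φ} → Rule₁ (Fml x (⟨ i ⟩ᶠ φ)) (Dia i φ x)
    Dia-Fml    : ∀ {x i φ} → Rule₁ (Dia i φ x) (Fml x φ)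
    Box-refl   : ∀ {x} → Rule₁ (Live x) (Box x x)
    Box-base   : ∀ {x} → Rule₁ (Live x) (Box (base x) x)
    Box-sym    : ∀ {x y} → Rule₁ (Box x y) (Box y x)
    Cell-sym   : ∀ {i x y} → Rule₁ (Cell i x y) (Cell i y x)
    Cell-Box   : ∀ {i x y} → Rule₁ (Cell i x y) (Box x y)
    D3-rule    : ∀ {i x y} → T (d3 X) → Rule₁ (Ought i x y) (Box x y)
    Ought-link : ∀ {i x y k p} → key y ≡ just (k , p) → Rule₁ (Ought i x y) (Box x p)
    D4-rule    : ∀ {i x y} → T (d4 X) → Rule₁ (Ought i x y) (OughtCell i x y)
    cell-Ought : ∀ {i x y} → Rule₁ (OughtCell i x y) (Ought i x y)
    D2-rule    : ∀ {x} → T (d2 X) × rank x < rankBound × level x < maxLevel → ∀ i →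
                 Rule₁ (Live x) (Live (out (i , inj₂ false) x))
    D5-rule    : ∀ {x} → T (d5 X) × rank x < rankBound × level x < maxLevel → ∀ i →
                 Rule₁ (Live x) (Live (out (i , inj₂ true) x))

  data Rule₂ : Fact → Fact → Fact → Set where
    ◇-rule   : ∀ {x y φ} → Rule₂ (Fml x (◇ᶠ φ)) (Box x y) (Fml y φ)
    ⊖-rule   : ∀ {i x y φ} → Rule₂ (Fml x (⊖ᶠ i φ)) (Ought i x y) (Fml y φ)
    Dia-cell : ∀ {i x y φ} → Rule₂ (Dia i φ x) (Cell i x y) (Dia i φ y)
    Box-trans : ∀ {x y z} → Rule₂ (Box x y) (Box y z) (Box x z)
    D1-rule  : ∀ {i x y z} → Rule₂ (Box x y) (Ought i x z) (Ought i y z)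
    D1-cell  : ∀ {i x y z} → Rule₂ (Box x y) (OughtCell i x z) (OughtCell i y z)
    cell-closed : ∀ {i x y z} → Rule₂ (OughtCell i x y) (Cell i y z) (OughtCell i x z)

  data Branching : Fact → Fact → Fact → Set where
    ∧-rule : ∀ {x φ ψ} → Branching (Fml x (φ ∧ᶠ ψ)) (Fml x φ) (Fml x ψ)

  data Clash : Fact → Fact → Set where
    id-rule : ∀ {x p} → Clash (Fml x (atom p)) (Fml x (natom p))

  creates? : ∀ b x → Dec (T b × rank x < rankBound × level x < maxLevel)
  creates? b x = T? b ×-dec (rank x <? rankBound ×-dec level x <? maxLevel)

  linkRule : ∀ i x y κ → key y ≡ κ → List (∃ (Rule₁ (Ought i x y)))
  linkRule i x y nothing  _  = []
  linkRule i x y (just _) eq = (_ , Ought-link eq) ∷ []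

  rules₁ : ∀ f → List (∃ (Rule₁ f))
  rules₁ (Fml x (φ ∨ᶠ ψ))   = (_ , ∨ˡ-rule) ∷ (_ , ∨ʳ-rule) ∷ []
  rules₁ (Fml x (□ᶠ φ))     = when (rank x <? rankBound) λ h → _ , □-rule h
  rules₁ (Fml x ([ i ]ᶠ φ)) = when (rank x <? rankBound) λ h → _ , []-rule h
  rules₁ (Fml x (⊗ᶠ i φ))   = when (rank x <? rankBound) λ h → _ , ⊗-rule h
  rules₁ (Fml x (⟨ i ⟩ᶠ φ)) = (_ , ⟨⟩-rule) ∷ []
  rules₁ (Fml x _)          = []
  rules₁ (Dia i φ x)        = (_ , Dia-Fml) ∷ []
  rules₁ (Live x)           = (_ , Box-refl) ∷ (_ , Box-base)
    ∷ concat (when (creates? (d2 X) x) λ h → map (λ i → _ , D2-rule h i) (allFin n))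
    ++ concat (when (creates? (d5 X) x) λ h → map (λ i → _ , D5-rule h i) (allFin n))
  rules₁ (Box x y)          = (_ , Box-sym) ∷ []
  rules₁ (Cell i x y)       = (_ , Cell-sym) ∷ (_ , Cell-Box) ∷ []
  rules₁ (Ought i x y)      = when (T? (d3 X)) (λ d → _ , D3-rule d) ++ when (T? (d4 X)) (λ d → _ , D4-rule d)
                              ++ linkRule i x y (key y) refl
  rules₁ (OughtCell i x y)  = (_ , cell-Ought) ∷ []

  rules₁-complete : ∀ {f g} → Rule₁ f g → ∃ λ r → (g , r) ∈ rules₁ f
  rules₁-complete ∨ˡ-rule    = _ , here refl
  rules₁-complete ∨ʳ-rule    = _ , there (here refl)
  rules₁-complete (□-rule {x} h)  = let h′ , p = ∈-when (rank x <? rankBound) h in □-rule h′ , p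
  rules₁-complete ([]-rule {x} h) = let h′ , p = ∈-when (rank x <? rankBound) h in []-rule h′ , p
  rules₁-complete (⊗-rule {x} h)  = let h′ , p = ∈-when (rank x <? rankBound) h in ⊗-rule h′ , p
  rules₁-complete ⟨⟩-rule    = _ , here refl
  rules₁-complete Dia-Fml    = _ , here refl
  rules₁-complete Box-refl   = _ , here refl
  rules₁-complete Box-base   = _ , there (here refl)
  rules₁-complete Box-sym    = _ , here refl
  rules₁-complete Cell-sym   = _ , here refl
  rules₁-complete Cell-Box   = _ , there (here refl)
  rules₁-complete (D3-rule d) = let d′ , p = ∈-when (T? (d3 X)) d in D3-rule d′ , ∈-++⁺ˡ p
  rules₁-complete (D4-rule d) = let d′ , p = ∈-when (T? (d4 X)) d in
    D4-rule d′ , ∈-++⁺ʳ (when (T? (d3 X)) _) (∈-++⁺ˡ p)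
  rules₁-complete (Ought-link {i} {x} {y} {k} {p} eq) =
    let r , q = go (key y) refl eq in r , ∈-++⁺ʳ (when (T? (d3 X)) _) (∈-++⁺ʳ (when (T? (d4 X)) _) q)
    where
    go : ∀ κ (e : key y ≡ κ) → κ ≡ just (k , p) → ∃ λ r → (Box x p , r) ∈ linkRule i x y κ e
    go _ e refl = _ , here refl
  rules₁-complete cell-Ought = _ , here refl
  rules₁-complete (D2-rule {x} h i) = let h′ , p = ∈-when (creates? (d2 X) x) h in
    D2-rule h′ i , there (there (∈-++⁺ˡ (∈-concat⁺′ (∈-map⁺ _ (∈-allFin i)) p)))
  rules₁-complete (D5-rule {x} h i) = let h′ , p = ∈-when (creates? (d5 X) x) h in
    D5-rule h′ i , there (there (∈-++⁺ʳ (concat (when (creates? (d2 X) x) _)) (∈-concat⁺′ (∈-map⁺ _ (∈-allFin i)) p)))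

  rules₂ : ∀ f g → List (∃ (Rule₂ f g))
  rules₂ (Fml x (◇ᶠ φ))   (Box x′ y)       = when (x ≟ x′) λ { refl → _ , ◇-rule }
  rules₂ (Fml x (⊖ᶠ i φ)) (Ought i′ x′ y)  = when (i Finₚ.≟ i′ ×-dec x ≟ x′) λ { (refl , refl) → _ , ⊖-rule }
  rules₂ (Dia i φ x)      (Cell i′ x′ y)   = when (i Finₚ.≟ i′ ×-dec x ≟ x′) λ { (refl , refl) → _ , Dia-cell }
  rules₂ (Box x y)        (Box y′ z)       = when (y ≟ y′) λ { refl → _ , Box-trans }
  rules₂ (Box x y)        (Ought i x′ z)   = when (x ≟ x′) λ { refl → _ , D1-rule }
  rules₂ (Box x y)        (OughtCell i x′ z) = when (x ≟ x′) λ { refl → _ , D1-cell }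
  rules₂ (OughtCell i x y) (Cell i′ y′ z)  = when (i Finₚ.≟ i′ ×-dec y ≟ y′) λ { (refl , refl) → _ , cell-closed }
  rules₂ _ _ = []

  rules₂-complete : ∀ {f g h} → Rule₂ f g h → ∃ λ r → (h , r) ∈ rules₂ f g
  rules₂-complete (◇-rule {x}) with refl , p ← ∈-when (x ≟ x) refl = _ , p
  rules₂-complete (⊖-rule {i} {x}) with (refl , refl) , p ← ∈-when (i Finₚ.≟ i ×-dec x ≟ x) (refl , refl) = _ , p
  rules₂-complete (Dia-cell {i} {x}) with (refl , refl) , p ← ∈-when (i Finₚ.≟ i ×-dec x ≟ x) (refl , refl) = _ , p
  rules₂-complete (Box-trans {y = y}) with refl , p ← ∈-when (y ≟ y) refl = _ , p
  rules₂-complete (D1-rule {x = x}) with refl , p ← ∈-when (x ≟ x) refl = _ , p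
  rules₂-complete (D1-cell {x = x}) with refl , p ← ∈-when (x ≟ x) refl = _ , p
  rules₂-complete (cell-closed {i} {y = y}) with (refl , refl) , p ← ∈-when (i Finₚ.≟ i ×-dec y ≟ y) (refl , refl) = _ , p

  branchings : ∀ f → List (∃₂ (Branching f))
  branchings (Fml x (φ ∧ᶠ ψ)) = (_ , _ , ∧-rule) ∷ []
  branchings _                = []

  clashes : ∀ f → List (∃ (Clash f))
  clashes (Fml x (atom p)) = (_ , id-rule) ∷ []
  clashes _                = []

  record Saturated (S : List Fact) : Set where
    field
      closed₁  : ∀ {f g} → Rule₁ f g → f ∈ S → g ∈ S
      closed₂  : ∀ {f g h} → Rule₂ f g h → f ∈ S → g ∈ S → h ∈ S
      branched : ∀ {f g h} → Branching f g h → f ∈ S → g ∈ S ⊎ h ∈ S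
      clashless : ∀ {f g} → Clash f g → f ∈ S → g ∉ S
      independent : ∀ xs → Tuple S xs → Live (ioa xs) ∈ S

  module _ (σ : State) (ih : Progress σ) where
    open Steps σ ih

    private
      c = conf σ
      R = rels c
      Γ = fmls c
      H = hist c
      S = facts c

      occ-edge : ∀ {i x y l} → Live x ∈ S → Live y ∈ S → OccR l (R⊗ {n} i (code x) (code y)) → LiveLabel S l
      occ-edge p q (inj₁ eq) = _ , p , eq
      occ-edge p q (inj₂ eq) = _ , q , eq

    apply₁ : ∀ {f g} → Rule₁ f g → f ∈ S → g ∉ S → Goal c
    apply₁ ∨ˡ-rule p = or-step p (here refl)
    apply₁ ∨ʳ-rule p = or-step p (there (here refl))
    apply₁ (□-rule h) p = inner-step nothing p h
    apply₁ ([]-rule {i = i} h) p = inner-step (just i) p h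
    apply₁ (⊗-rule {x} {φ = φ} h) p = ⊗-step live h (≤-trans (s≤s (m≤n+m (level x) (suc (depth φ)))) depth<) p
      where open FmlOK (sound σ p)
    apply₁ (⟨⟩-rule {x} {i} {φ}) p = note σ ih (Dia i φ x) record
      { live = live ; ∈Cl = Cl-closed ∈Cl ⟨⟩◁ ; depth< = depth< ; src = x ; liveSrc = live
      ; present = [ id , (λ ()) ]′ present⊎resolved ; path = ∼refl }
      where open FmlOK (sound σ p)
    apply₁ Dia-Fml p g∉ = ⟨⟩R present path (addFml σ ih live ∈Cl depth< g∉)
      where open DiaOK (sound σ p)
    apply₁ (Box-refl {x}) p = note σ ih (Box x x) record { liveˡ = p ; liveʳ = p ; key≡ = refl ; path = ◇refl }
    apply₁ (Box-base {x}) p = note σ ih (Box (base x) x) record { liveˡ = liveBase ; liveʳ = p ; key≡ = key-base x ; path = base∼ }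
      where open LiveOK (sound σ p)
    apply₁ (Box-sym {x} {y}) p = note σ ih (Box y x) record { liveˡ = liveʳ ; liveʳ = liveˡ ; key≡ = sym key≡ ; path = ∼◇-sym path }
      where open BoxOK (sound σ p)
    apply₁ (Cell-sym {i} {x} {y}) p = note σ ih (Cell i y x) record { liveˡ = liveʳ ; liveʳ = liveˡ ; key≡ = sym key≡ ; path = ∼-sym path }
      where open CellOK (sound σ p)
    apply₁ (Cell-Box {i} {x} {y}) p = note σ ih (Box x y) record { liveˡ = liveˡ ; liveʳ = liveʳ ; key≡ = key≡ ; path = ∼⇒∼◇ path }
      where open CellOK (sound σ p)
    apply₁ (D3-rule {i} {x} {y} d) p g∉ = D3 d (proj₂ (sound σ p)) (addRels σ ih (R□ (code x) (code y) ∷ []) (Box x y)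
      record { liveˡ = liveˡ ; liveʳ = liveʳ ; key≡ = trans (d3⇒key≡nothing d x) (sym (d3⇒key≡nothing d y)) ; path = ◇fwd□ (here refl) ◇refl }
      (λ { (here o) → occ-edge {i} liveˡ liveʳ o }) g∉)
      where open EdgeOK (proj₁ (sound σ p))
    apply₁ (Ought-link {i} {x} {y} {k} {p} eq) q = note σ ih (Box x p) record
      { liveˡ = liveˡ ; liveʳ = LiveOK.liveParent (sound σ liveʳ) eq ; key≡ = trans key≡ (cong parentKey eq) ; path = link eq }
      where open EdgeOK (proj₁ (sound σ q))
    apply₁ (D4-rule {i} {x} {y} d) p = note σ ih (OughtCell i x y) (proj₁ (sound σ p) , record
      { src = x ; target = code y ; liveSrc = EdgeOK.liveˡ (proj₁ (sound σ p)) ; src∼ = ◇refl ; target∼ = ∼refl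
      ; reason = inj₂ (d , proj₂ (sound σ p)) })
    apply₁ (cell-Ought {i} {x} {y}) p g∉ =
      [ (λ (d , h) → D5² d h target∼ rest) , (λ (d , r) → D4 d r target∼ rest) ]′ reason
      where
      open CellSource (proj₂ (sound σ p))
      open EdgeOK (proj₁ (sound σ p))
      rest : Der X H (R⊗ i (code src) (code y) ∷ R) Γ
      -- (D5²) or (D4) yields an edge from the original source; (D1) then moves it along the □-path
      -- to `x`.
      rest = D1 (here refl) (∼◇-mono there src∼)
        (addRels σ ih (R⊗ i (code x) (code y) ∷ R⊗ i (code src) (code y) ∷ []) (Ought i x y)
          (record { liveˡ = liveˡ ; liveʳ = liveʳ ; key≡ = key≡ ; link = ∼◇-mono (there ∘ there) ∘ link } , here refl)
          (λ { (here o) → occ-edge {i} liveˡ liveʳ o ; (there (here o)) → occ-edge {i} liveSrc liveʳ o }) g∉)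
    apply₁ (D2-rule (d , hr , hl) i) p = D2-step p hr hl d
    apply₁ (D5-rule (d , hr , hl) i) p = D5-step p hr hl d

    private
      move-edge : ∀ {x y z} → BoxOK c x y → EdgeOK c x z → EdgeOK c y z
      move-edge b e = record
        { liveˡ = BoxOK.liveʳ b ; liveʳ = EdgeOK.liveʳ e ; key≡ = trans (sym (BoxOK.key≡ b)) (EdgeOK.key≡ e)
        ; link = λ eq → ∼◇-trans (∼◇-sym (BoxOK.path b)) (EdgeOK.link e eq) }

    apply₂ : ∀ {f g h} → Rule₂ f g h → f ∈ S → g ∈ S → h ∉ S → Goal c
    apply₂ (◇-rule {x} {y} {φ}) p q h∉ = ◇R ([ id , (λ ()) ]′ present⊎resolved) path
      (addFml σ ih liveʳ (Cl-closed ∈Cl ◇◁) (subst (λ l → depth φ + l < maxLevel) (key-level {x} {y} key≡) depth<) h∉)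
      where
      open FmlOK (sound σ p)
      open BoxOK (sound σ q)
    apply₂ (⊖-rule {i} {x} {y} {φ}) p q h∉ = ⊖R (proj₂ (sound σ q)) ([ id , (λ ()) ]′ present⊎resolved)
      (addFml σ ih liveʳ (Cl-closed ∈Cl ⊖◁)
        (≤-trans (s≤s (≤-trans (+-monoʳ-≤ (depth φ) (parentKey-level {x} {y} key≡)) (≤-reflexive (ℕₚ.+-suc (depth φ) (level x))))) depth<) h∉)
      where
      open FmlOK (sound σ p)
      open EdgeOK (proj₁ (sound σ q))
    apply₂ (Dia-cell {i} {x} {y} {φ}) p q = note σ ih (Dia i φ y) record
      { live = CellOK.liveʳ s ; ∈Cl = ∈Cl ; depth< = subst (λ l → depth φ + l < maxLevel) (key-level {x} {y} (CellOK.key≡ s)) depth<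
      ; src = src ; liveSrc = liveSrc ; present = present ; path = ∼-trans path (CellOK.path s) }
      where
      open DiaOK (sound σ p)
      s = sound σ q
    apply₂ (Box-trans {x} {y} {z}) p q = note σ ih (Box x z) record
      { liveˡ = BoxOK.liveˡ s ; liveʳ = BoxOK.liveʳ t ; key≡ = trans (BoxOK.key≡ s) (BoxOK.key≡ t)
      ; path = ∼◇-trans (BoxOK.path s) (BoxOK.path t) }
      where
      s = sound σ p
      t = sound σ q
    apply₂ (D1-rule {i} {x} {y} {z}) p q h∉ = D1 (proj₂ (sound σ q)) (BoxOK.path (sound σ p))
      (addRels σ ih (R⊗ i (code y) (code z) ∷ []) (Ought i y z)
        (record { liveˡ = liveˡ ; liveʳ = liveʳ ; key≡ = key≡ ; link = ∼◇-mono there ∘ link } , here refl)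
        (λ { (here o) → occ-edge {i} liveˡ liveʳ o }) h∉)
      where open EdgeOK (move-edge (sound σ p) (proj₁ (sound σ q)))
    apply₂ (D1-cell {i} {x} {y} {z}) p q = note σ ih (OughtCell i y z)
      (move-edge (sound σ p) (proj₁ (sound σ q)) , record
        { src = src ; target = target ; liveSrc = liveSrc ; src∼ = ∼◇-trans src∼ (BoxOK.path (sound σ p))
        ; target∼ = target∼ ; reason = reason })
      where open CellSource (proj₂ (sound σ q))
    apply₂ (cell-closed {i} {x} {y} {z}) p q = note σ ih (OughtCell i x z)
      (record { liveˡ = liveˡ ; liveʳ = CellOK.liveʳ s ; key≡ = trans key≡ (cong parentKey (CellOK.key≡ s))
              ; link = link ∘ trans (CellOK.key≡ s) }
      , record { src = src ; target = target ; liveSrc = liveSrc ; src∼ = src∼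
               ; target∼ = ∼-trans target∼ (CellOK.path s) ; reason = reason })
      where
      open EdgeOK (proj₁ (sound σ p))
      open CellSource (proj₂ (sound σ p))
      s = sound σ q

    branch : ∀ {f g h} → Branching f g h → f ∈ S → g ∉ S → h ∉ S → Goal c
    branch ∧-rule = and-step

    close : ∀ {f g} → Clash f g → f ∈ S → g ∈ S → Goal c
    close id-rule p q = ax ([ id , (λ ()) ]′ (FmlOK.present⊎resolved (sound σ p))) ([ id , (λ ()) ]′ (FmlOK.present⊎resolved (sound σ q)))

    private
      ∈⊎∉ : ∀ f → f ∈ S ⊎ f ∉ S
      ∈⊎∉ f with f ∈? S
      ... | yes p = inj₁ p
      ... | no ¬p = inj₂ ¬p

      both⊎ : ∀ f g → (f ∈ S ⊎ g ∈ S) ⊎ (f ∉ S × g ∉ S)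
      both⊎ f g with f ∈? S | g ∈? S
      ... | yes p | _     = inj₁ (inj₁ p)
      ... | no _  | yes q = inj₁ (inj₂ q)
      ... | no ¬p | no ¬q = inj₂ (¬p , ¬q)

      Tuple? : Decidable (Tuple S)
      Tuple? xs = all? (λ j → Live (lookup xs j) ∈? S ×-dec rank (lookup xs j) <? rankBound)
                  ×-dec all? (λ j → all? λ k → Box (lookup xs j) (lookup xs k) ∈? S)

      tuple⊎ : ∀ xs → (Tuple S xs → Live (ioa xs) ∈ S) ⊎ (Tuple S xs × Live (ioa xs) ∉ S)
      tuple⊎ xs with Tuple? xs | Live (ioa xs) ∈? S
      ... | _     | yes p = inj₁ λ _ → p
      ... | no ¬t | no _  = inj₁ λ t → contradiction t ¬t
      ... | yes t | no ¬p = inj₂ (t , ¬p)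

    -- Every closure condition ranges over a finite list and is decidable; a violation is a rule
    -- instance whose conclusion is missing, or a clash that closes the branch at once.
    goal⊎saturated : Goal c ⊎ Saturated S
    goal⊎saturated
      with All.decide (λ f → All.decide (λ (g , _) → ∈⊎∉ g) (rules₁ f)) S
         | All.decide (λ f → All.decide (λ g → All.decide (λ (h , _) → ∈⊎∉ h) (rules₂ f g)) S) S
         | All.decide (λ f → All.decide (λ (g , h , _) → both⊎ g h) (branchings f)) S
         | All.decide (λ f → All.decide (λ (g , _) → swap (∈⊎∉ g)) (clashes f)) S
         | All.decide tuple⊎ (vecs names n)
    ... | inj₂ bad | _ | _ | _ | _ =
      let _ , f∈ , bad′ = find bad ; (_ , r) , _ , g∉ = find bad′ in inj₁ (apply₁ r f∈ g∉)
    ... | _ | inj₂ bad | _ | _ | _ =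
      let _ , f∈ , bad′ = find bad ; _ , g∈ , bad″ = find bad′ ; (_ , r) , _ , h∉ = find bad″ in inj₁ (apply₂ r f∈ g∈ h∉)
    ... | _ | _ | inj₂ bad | _ | _ =
      let _ , f∈ , bad′ = find bad ; (_ , _ , r) , _ , g∉ , h∉ = find bad′ in inj₁ (branch r f∈ g∉ h∉)
    ... | _ | _ | _ | inj₂ bad | _ =
      let _ , f∈ , bad′ = find bad ; (_ , r) , _ , g∈ = find bad′ in inj₁ (close r f∈ g∈)
    ... | _ | _ | _ | _ | inj₂ bad =
      let _ , _ , t , y∉ = find bad in inj₁ (ioa-step t y∉)
    ... | inj₁ ok₁ | inj₁ ok₂ | inj₁ ok₃ | inj₁ ok₄ | inj₁ ok₅ = inj₂ record
      { closed₁ = λ r f∈ → All.lookup (All.lookup ok₁ f∈) (proj₂ (rules₁-complete r))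
      ; closed₂ = λ r f∈ g∈ → All.lookup (All.lookup (All.lookup ok₂ f∈) g∈) (proj₂ (rules₂-complete r))
      ; branched = λ { ∧-rule f∈ → All.lookup (All.lookup ok₃ f∈) (here refl) }
      ; clashless = λ { id-rule f∈ → All.lookup (All.lookup ok₄ f∈) (here refl) }
      -- Entries of a `Tuple` are live, hence bounded, so checking the vectors over `names` covers
      -- all of them.
      ; independent = λ xs t → All.lookup ok₅ (∈-vecs xs λ j → Bounded⇒∈names (bounded-live σ (proj₁ (proj₁ t j)))) t }

  -- Well-founded induction on the number of facts of `universe` still missing. Saturated states are
  -- excluded only above the given one, because the countermodel needs the initial facts to be
  -- retained.
  search : ∀ σ → (∀ σ′ → facts (conf σ) ⊆ facts (conf σ′) → ¬ Saturated (facts (conf σ′))) → Goal (conf σ)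
  search σ = go σ (<-wellFounded _)
    where
    go : ∀ σ → Acc _<_ (missing (_∈? facts (conf σ)) universe) →
         (∀ σ′ → facts (conf σ) ⊆ facts (conf σ′) → ¬ Saturated (facts (conf σ′))) → Goal (conf σ)
    go σ (acc rec) ¬sat = [ id , (λ sat → contradiction sat (¬sat σ id)) ]′ (goal⊎saturated σ λ σ′ S⊆S′ f∈ f∉ →
      go σ′ (rec (missing-< (_∈? facts (conf σ)) (_∈? facts (conf σ′)) S⊆S′ (sound⇒∈universe σ′ f∈) f∈ f∉))
            λ σ″ S′⊆S″ → ¬sat σ″ (S′⊆S″ ∘ S⊆S′))

  -- The initial state of the search

  relFact : RAtom n → Fact
  relFact (R□ x y)    = Box (root x) (root y)
  relFact (R[] i x y) = Cell i (root x) (root y)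
  relFact (R⊗ i x y)  = Ought i (root x) (root y)

  fmlFact : LFm n → Fact
  fmlFact (x ∶ φ) = Fml (root x) φ

  liveFact : Label → Fact
  liveFact x = Live (root x)

  rel-root : ∀ {a x} → a ∈ R₀ → x ∈ labelsOf a → x ∈ Roots
  rel-root p q = there (∈-++⁺ˡ (∈-concat⁺′ q (∈-map⁺ labelsOf p)))

  fml-root : ∀ {A} → A ∈ Γ₀ → LFm.lab A ∈ Roots
  fml-root p = there (∈-++⁺ʳ (concat (map labelsOf R₀)) (∈-map⁺ LFm.lab p))

  S₀ : List Fact
  S₀ = map liveFact Roots ++ map relFact R₀ ++ map fmlFact Γ₀

  live∈S₀ : ∀ {x} → x ∈ Roots → Live (root x) ∈ S₀
  live∈S₀ = ∈-++⁺ˡ ∘ ∈-map⁺ liveFact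

  rel∈S₀ : ∀ {a} → a ∈ R₀ → relFact a ∈ S₀
  rel∈S₀ = ∈-++⁺ʳ (map liveFact Roots) ∘ ∈-++⁺ˡ ∘ ∈-map⁺ relFact

  fml∈S₀ : ∀ {A} → A ∈ Γ₀ → fmlFact A ∈ S₀
  fml∈S₀ = ∈-++⁺ʳ (map liveFact Roots) ∘ ∈-++⁺ʳ (map relFact R₀) ∘ ∈-map⁺ fmlFact

  initial : State
  initial = record
    { conf = c₀
    ; sound = λ p → case ∈-++⁻ (map liveFact Roots) p of λ
        { (inj₁ q) → let _ , r , eq = ∈-map⁻ liveFact q in subst (Sound c₀) (sym eq) (live r)
        ; (inj₂ q) → case ∈-++⁻ (map relFact R₀) q of λ
          { (inj₁ q) → let a , r , eq = ∈-map⁻ relFact q in subst (Sound c₀) (sym eq) (rel a r)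
          ; (inj₂ q) → let A , r , eq = ∈-map⁻ fmlFact q in subst (Sound c₀) (sym eq) (fml r) } }
    ; relsLive = λ o → let a , p , q = find o in occ a p q
    ; fmlsLive = λ p → _ , live∈S₀ (fml-root p) , refl }
    where
    c₀ = config R₀ Γ₀ [] S₀
    live : ∀ {x} → x ∈ Roots → LiveOK c₀ (root x)
    live p = record { bounded = root-bounded p ; base∼ = ◇refl ; liveBase = live∈S₀ p ; liveParent = λ () ; made = tt }
    rel : ∀ a → a ∈ R₀ → Sound c₀ (relFact a)
    rel (R□ x y) p = record
      { liveˡ = live∈S₀ (rel-root p (here refl)) ; liveʳ = live∈S₀ (rel-root p (there (here refl)))
      ; key≡ = refl ; path = ◇fwd□ p ◇refl }
    rel (R[] i x y) p = record
      { liveˡ = live∈S₀ (rel-root p (here refl)) ; liveʳ = live∈S₀ (rel-root p (there (here refl)))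
      ; key≡ = refl ; path = ∼fwd p ∼refl }
    rel (R⊗ i x y) p = record
      { liveˡ = live∈S₀ (rel-root p (here refl)) ; liveʳ = live∈S₀ (rel-root p (there (here refl)))
      ; key≡ = refl ; link = λ () } , p
    fml : ∀ {A} → A ∈ Γ₀ → Sound c₀ (fmlFact A)
    fml {x ∶ φ} p = record
      { live = live∈S₀ (fml-root p) ; ∈Cl = ∈-Cl p
      ; depth< = s≤s (≤-trans (≤-reflexive (ℕₚ.+-identityʳ (depth φ))) (∈⇒≤sum (∈-map⁺ (depth ∘ LFm.fm) p)))
      ; present⊎resolved = inj₁ p }
    occ : ∀ a {l} → a ∈ R₀ → OccR l a → LiveLabel S₀ l
    occ (R□ x y)    p (inj₁ refl) = _ , live∈S₀ (rel-root p (here refl)) , refl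
    occ (R□ x y)    p (inj₂ refl) = _ , live∈S₀ (rel-root p (there (here refl))) , refl
    occ (R[] i x y) p (inj₁ refl) = _ , live∈S₀ (rel-root p (here refl)) , refl
    occ (R[] i x y) p (inj₂ refl) = _ , live∈S₀ (rel-root p (there (here refl))) , refl
    occ (R⊗ i x y)  p (inj₁ refl) = _ , live∈S₀ (rel-root p (here refl)) , refl
    occ (R⊗ i x y)  p (inj₂ refl) = _ , live∈S₀ (rel-root p (there (here refl))) , refl

  -- The countermodel of a saturated state

  module Countermodel (σ : State) (sat : Saturated (facts (conf σ))) where
    open Saturated sat

    private
      S = facts (conf σ)

      box-key : ∀ {x y} → Box x y ∈ S → key x ≡ key y
      box-key p = BoxOK.key≡ (sound σ p)

      box-refl : ∀ {x} → Live x ∈ S → Box x x ∈ S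
      box-refl = closed₁ Box-refl

      box-sym : ∀ {x y} → Box x y ∈ S → Box y x ∈ S
      box-sym = closed₁ Box-sym

      box-trans : ∀ {x y z} → Box x y ∈ S → Box y z ∈ S → Box x z ∈ S
      box-trans = closed₂ Box-trans

    -- Realised types, and replacing labels by twins

    Realised : Key → ℕ → List Bool → Set
    Realised κ k τ = Any (λ x → Live x ∈ S × key x ≡ κ × rank x ≤ k × typeOf S x ≡ τ) names

    Realised? : ∀ κ k → Decidable (Realised κ k)
    Realised? κ k τ = any? (λ x → Live x ∈? S ×-dec (key x ≟ᵏ κ ×-dec (rank x ≤? k ×-dec Listₚ.≡-dec Boolₚ._≟_ (typeOf S x) τ))) names

    abstract
      stableRank : ∀ κ → ∃ λ k → k ≤ length allTypes × (∀ {τ} → τ ∈ allTypes → Realised κ (suc k) τ → Realised κ k τ)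
      stableRank κ = stabilise (Realised? κ) (Any.map λ (l , e , r , t) → l , e , ℕₚ.m≤n⇒m≤1+n r , t) allTypes

    height : Key → ℕ
    height κ = proj₁ (stableRank κ)

    World : Set
    World = Σ Name λ x → Live x ∈ S × rank x ≤ height (key x)

    world-rank : (w : World) → rank (proj₁ w) < rankBound
    world-rank (x , _ , le) = ≤-trans (s≤s (≤-trans le (proj₁ (proj₂ (stableRank (key x)))))) types<rankBound

    record Twin (y x : Name) : Set where
      field
        key≡  : key x ≡ key y
        type≡ : typeOf S x ≡ typeOf S y

    -- The height is chosen so that rank `suc (height κ)` realises no new type; labels just above
    -- the worlds are thus replaceable within the same key.
    representative : ∀ y → Live y ∈ S → rank y ≤ suc (height (key y)) → Σ World λ w → Twin y (proj₁ w)
    representative y y∈ le with find (proj₂ (proj₂ (stableRank (key y))) (typeOf∈allTypes S y)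
                                  (lose (Bounded⇒∈names (bounded-live σ y∈)) (y∈ , refl , le , refl)))
    ... | x , _ , x∈ , key≡ , le′ , type≡ =
      (x , x∈ , subst (λ κ → rank x ≤ height κ) (sym key≡) le′) , record { key≡ = key≡ ; type≡ = type≡ }

    -- Several root clusters share the key `nothing`, and there the type supplies a box to a common
    -- root. Any other key determines the base, to which both names are boxed.
    twin-box : ∀ {y x} → Live y ∈ S → Live x ∈ S → Twin y x → Box y x ∈ S
    twin-box {y} {x} y∈ x∈ t = go (origin y) refl
      where
      open Twin t
      go : ∀ o → origin y ≡ o → Box y x ∈ S
      go (inj₁ r) eq = box-trans (box-sym r∼y) (typeOf-≡⇒ (sym type≡) (Box∈probes (Bounded.rooted (bounded-live σ y∈) eq)) r∼y)
        where
        r∼y : Box (root r) y ∈ S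
        r∼y = subst (λ z → Box z y ∈ S) (origin⇒base {y} eq) (closed₁ Box-base y∈)
      go (inj₂ z) eq = box-trans (box-sym (closed₁ Box-base y∈)) (subst (λ b → Box b x ∈ S) base≡ (closed₁ Box-base x∈))
        where
        base≡ : base x ≡ base y
        base≡ = trans (origin⇒base {x} (key≡just x (trans key≡ (origin⇒key {y} eq)))) (sym (origin⇒base {y} eq))

    -- The enlarged [i]-classes and the transfer of ⊗-edges

    record _≼[_]_ (x : Name) (i : Fin n) (y : Name) : Set where
      field
        dias  : ∀ {φ} → φ ∈ Cl → Dia i φ x ∈ S → Dia i φ y ∈ S
        cells : ∀ {r} → r ∈ Roots → OughtCell i (source (key x) r) x ∈ S → OughtCell i (source (key y) r) y ∈ S
    open _≼[_]_

    ≼-refl : ∀ {i x} → x ≼[ i ] x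
    ≼-refl = record { dias = λ _ → id ; cells = λ _ → id }

    ≼-trans : ∀ {i x y z} → x ≼[ i ] y → y ≼[ i ] z → x ≼[ i ] z
    ≼-trans p q = record { dias = λ h → dias q h ∘ dias p h ; cells = λ h → cells q h ∘ cells p h }

    cell-≼ : ∀ {i x y} → Cell i x y ∈ S → x ≼[ i ] y
    cell-≼ {i} {x} {y} p = record
      { dias = λ _ q → closed₂ Dia-cell q p
      ; cells = λ {r} _ q → subst (λ κ → OughtCell i (source κ r) y ∈ S) (CellOK.key≡ (sound σ p)) (closed₂ cell-closed q p) }

    type-≼ : ∀ {i x y} → typeOf S x ≡ typeOf S y → x ≼[ i ] y
    type-≼ {i} eq = record { dias = λ h → typeOf-≡⇒ eq (Dia∈probes i h) ; cells = λ h → typeOf-≡⇒ eq (OughtCell∈probes i h) }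

    -- Agreement in both directions makes this an equivalence by definition. It asks for no actual
    -- [i]-path, so replacing a witness by its twin cannot break it.
    Choice : Fin n → Name → Name → Set
    Choice i x y = Box x y ∈ S × x ≼[ i ] y × y ≼[ i ] x

    cell-twin : ∀ {i x y z} → Cell i x y ∈ S → Live z ∈ S → Twin y z → Choice i x z
    cell-twin p z∈ t =
        box-trans (closed₁ Cell-Box p) (twin-box (CellOK.liveʳ (sound σ p)) z∈ t)
      , ≼-trans (cell-≼ p) (type-≼ (sym (Twin.type≡ t)))
      , ≼-trans (type-≼ (Twin.type≡ t)) (cell-≼ (closed₁ Cell-sym p))

    cell-choice : ∀ {i x y} → Cell i x y ∈ S → Choice i x y
    cell-choice p = cell-twin p (CellOK.liveʳ (sound σ p)) record { key≡ = refl ; type≡ = refl }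

    edge-source : ∀ {i x y} → Ought i x y ∈ S → ∃ λ r → r ∈ Roots × Box x (source (key y) r) ∈ S
    edge-source {i} {x} {y} p = go (key y) refl
      where
      open EdgeOK (proj₁ (sound σ p))
      go : ∀ κ → key y ≡ κ → ∃ λ r → r ∈ Roots × Box x (source κ r) ∈ S
      go nothing eq =
        let r , eq′ = key≡nothing x (trans key≡ (cong parentKey eq)) in
        r , Bounded.rooted (bounded-live σ liveˡ) eq′
          , box-sym (subst (λ z → Box z x ∈ S) (origin⇒base {x} eq′) (closed₁ Box-base liveˡ))
      -- `0` is a placeholder root: below this key `source` ignores it.
      go (just _) eq = 0 , here refl , closed₁ (Ought-link eq) p

    -- Types see only edges from canonical sources. (D1) moves the edge to such a source, the common
    -- type transfers it to the twin, and (D1) moves it back to `x`.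
    ought-twin : ∀ {i x y z} → Ought i x y ∈ S → Twin y z → Ought i x z ∈ S
    ought-twin {i} {x} {y} {z} p t =
      let r , r∈ , b = edge-source p
          q = typeOf-≡⇒ (sym type≡) (Ought∈probes i r∈) (closed₂ D1-rule b p)
      in closed₂ D1-rule (box-sym b) (subst (λ κ → Ought i (source κ r) z ∈ S) key≡ q)
      where open Twin t

    -- The same detour through a canonical source, with agreement on `OughtCell` in place of
    -- equality of types. It is what makes (D4) and (D5) survive the enlargement of the classes.
    cell-choose : ∀ {i x y z} → OughtCell i x y ∈ S → Choice i y z → OughtCell i x z ∈ S
    cell-choose {i} {x} {y} {z} p (b , y≼z , _) =
      let r , r∈ , b′ = edge-source (closed₁ cell-Ought p)
          q = cells y≼z r∈ (closed₂ D1-cell b′ p)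
      in closed₂ D1-cell (box-sym b′) (subst (λ κ → OughtCell i (source κ r) z ∈ S) (sym (box-key b)) q)

    inn-representative : ∀ k (w : World) → Live (inn k (proj₁ w)) ∈ S → Σ World λ v → Twin (inn k (proj₁ w)) (proj₁ v)
    inn-representative k (x , _ , le) y∈ = representative (inn k x) y∈ (s≤s le)

    -- A staying successor exceeds the height of its cluster by at most one; a leaving one starts
    -- its cluster with rank 0.
    out-representative : ∀ k (w : World) → Live (out k (proj₁ w)) ∈ S → Σ World λ v → Twin (out k (proj₁ w)) (proj₁ v)
    out-representative k (x , _ , le) y∈ = representative (out k x) y∈ (rank≤ (staying⊎leaving k x))
      where
      rank≤ : Staying k x ⊎ Leaving k x → rank (out k x) ≤ suc (height (key (out k x)))
      rank≤ (inj₁ s) = let open Staying s in ≤-trans (≤-reflexive rank≡)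
        (s≤s (subst (λ κ → rank x ≤ height κ) (sym (origin⇒key {out k x} origin≡)) le))
      rank≤ (inj₂ s) = ≤-trans (≤-reflexive (Leaving.rank≡ s)) z≤n

    -- The frame and its conditions

    Rb : Maybe World → Maybe World → Set
    Rb (just (x , _)) (just (y , _)) = Box x y ∈ S
    Rb nothing        nothing        = ⊤
    Rb _              _              = ⊥

    Ra : Fin n → Maybe World → Maybe World → Set
    Ra i (just (x , _)) (just (y , _)) = Choice i x y
    Ra i nothing        nothing        = ⊤
    Ra i _              _              = ⊥

    -- nothing is an extra world without formulas, the successor of the worlds of maximal level
    -- (which carry no formulas either, and to which (D2) and (D5) are not applied).
    Ro : Fin n → Maybe World → Maybe World → Set
    Ro i (just (x , _)) (just (y , _)) = Ought i x y ∈ S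
    Ro i (just (x , _)) nothing        = maxLevel ≤ level x
    Ro i nothing        (just _)       = ⊥
    Ro i nothing        nothing        = ⊤

    -- The `ioa` label of the chosen worlds has rank at most one above the height of their cluster.
    -- Its twin agrees with the j-th world on what [j]-paths propagate, for every j, so it lies in
    -- all the enlarged classes.
    independence : ∀ w (u : Fin n → Maybe World) → (∀ i → Rb w (u i)) → ∃ λ v → ∀ i → Ra i (u i) v
    independence nothing u h = nothing , λ i → go (u i) (h i)
      where
      go : ∀ {i} v → Rb nothing v → Ra i v nothing
      go nothing _ = tt
    independence (just w) u h = just v , λ i → subst (λ z → Ra i z (just v)) (sym (proj₁ (proj₂ (member i))))
        (subst (λ z → Choice i z (proj₁ v)) (lookup∘tabulate name i) (cell-twin (made i) (proj₁ (proj₂ v)) twin))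
      where
      unwrap : ∀ v → Rb (just w) v → Σ World λ v′ → v ≡ just v′ × Box (proj₁ w) (proj₁ v′) ∈ S
      unwrap (just v′) b = v′ , refl , b
      member : ∀ i → Σ World λ v → u i ≡ just v × Box (proj₁ w) (proj₁ v) ∈ S
      member i = unwrap (u i) (h i)
      name : Fin n → Name
      name i = proj₁ (proj₁ (member i))
      xs : Vec Name n
      xs = tabulate name
      lookup-xs : ∀ {P : Name → Set} j → P (name j) → P (lookup xs j)
      lookup-xs {P} j = subst P (sym (lookup∘tabulate name j))
      box : ∀ j → Box (proj₁ w) (lookup xs j) ∈ S
      box j = lookup-xs {λ z → Box (proj₁ w) z ∈ S} j (proj₂ (proj₂ (member j)))
      y∈ : Live (ioa xs) ∈ S
      y∈ = independent xs
        ( (λ j → lookup-xs {λ z → Live z ∈ S × rank z < rankBound} j (proj₁ (proj₂ (proj₁ (member j))) , world-rank (proj₁ (member j))))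
        , λ j k → box-trans (box-sym (box j)) (box k))
      made : ∀ j → Cell j (lookup xs j) (ioa xs) ∈ S
      made = LiveOK.made (sound σ y∈)
      rank≤ : ∀ j → rank (lookup xs j) ≤ height (key (ioa xs))
      rank≤ j = subst (λ κ → rank (lookup xs j) ≤ height κ) (CellOK.key≡ (sound σ (made j)))
        (lookup-xs {λ z → rank z ≤ height (key z)} j (proj₂ (proj₂ (proj₁ (member j)))))
      rep = representative (ioa xs) y∈ (s≤s (maxRank≤ xs rank≤))
      v = proj₁ rep
      twin = proj₂ rep

    frame : DSFrame n
    frame = record
      { W = Maybe World ; w₀ = nothing ; Rb = Rb ; Ra = Ra ; Ro = Ro
      ; C1 = record
        { refl = λ { {just (_ , x∈ , _)} → box-refl x∈ ; {nothing} → tt }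
        ; sym = λ { {just _} {just _} → box-sym ; {nothing} {nothing} → id }
        ; trans = λ { {just _} {just _} {just _} → box-trans ; {nothing} {nothing} {nothing} _ → id } }
      ; C2eq = λ i → record
        { refl = λ { {just (_ , x∈ , _)} → box-refl x∈ , ≼-refl , ≼-refl ; {nothing} → tt }
        ; sym = λ { {just _} {just _} (b , p , q) → box-sym b , q , p ; {nothing} {nothing} → id }
        ; trans = λ { {just _} {just _} {just _} (b , p , q) (b′ , p′ , q′) → box-trans b b′ , ≼-trans p p′ , ≼-trans q′ q
                    ; {nothing} {nothing} {nothing} _ → id } }
      ; C2⊆ = λ { i {just _} {just _} → proj₁ ; i {nothing} {nothing} → id }
      ; C3 = independence
      ; D1f = λ { i {just _} {just _} {just _} b → closed₂ D1-rule b
                ; i {just (x , _)} {just (y , _)} {nothing} b → subst (maxLevel ≤_) (key-level {x} {y} (box-key b))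
                ; i {nothing} {nothing} {nothing} _ → id } }

    satX : SatX X frame
    satX = record
      { D2f = D2f
      ; D3f = λ { d i {just _} {just _} → closed₁ (D3-rule d)
                -- Under (D3) every level is 0 while `maxLevel` is positive; `root 0` is just some
                -- name with key `nothing`.
                ; d i {just (x , _)} {nothing} le →
                    case ≤-trans le (≤-reflexive (key-level {x} {root 0} (d3⇒key≡nothing d x))) of λ ()
                ; d i {nothing} {nothing} → id }
      -- An `Ought` edge alone need not extend to the enlarged class; (D4) first promotes it to
      -- `OughtCell`, which does.
      ; D4f = λ { d i {just _} {just _} {just _} p q → closed₁ cell-Ought (cell-choose (closed₁ (D4-rule d) p) q)
                ; d i {just _} {nothing} {nothing} p _ → p
                ; d i {nothing} {nothing} {nothing} _ → id }
      ; D5f = D5f }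
      where
      D2f : T (d2 X) → ∀ i w → ∃ λ v → Ro i w v
      D2f d i nothing = nothing , tt
      D2f d i (just w@(x , x∈ , _)) with level x <? maxLevel
      ... | no ≮   = nothing , ℕₚ.≮⇒≥ ≮
      ... | yes lt =
        let y∈ = closed₁ (D2-rule (d , world-rank w , lt) i) x∈
            v , t = out-representative (i , inj₂ false) w y∈
        in just v , ought-twin (LiveOK.made (sound σ y∈)) t
      D5f : T (d5 X) → ∀ i w → ∃ λ v → Ro i w v × (∀ u → Ra i v u → Ro i w u)
      D5f d i nothing = nothing , tt , λ { nothing _ → tt }
      D5f d i (just w@(x , x∈ , _)) with level x <? maxLevel
      ... | no ≮   = nothing , ℕₚ.≮⇒≥ ≮ , λ { nothing _ → ℕₚ.≮⇒≥ ≮ }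
      ... | yes lt =
        let y∈ = closed₁ (D5-rule (d , world-rank w , lt) i) x∈
            v , t = out-representative (i , inj₂ true) w y∈
            p = cell-choose (LiveOK.made (sound σ y∈))
                  (twin-box y∈ (proj₁ (proj₂ v)) t , type-≼ (sym (Twin.type≡ t)) , type-≼ (Twin.type≡ t))
        in just v , closed₁ cell-Ought p , λ { (just _) q → closed₁ cell-Ought (cell-choose p q) }

    -- Valuation, refutation of the recorded formulas, and the given sequent

    V : Atm → Maybe World → Set
    -- Chosen so that a negated atom to be falsified fails immediately; an atom to be falsified
    -- fails because saturated states have no clash.
    V p (just (x , _)) = Fml x (natom p) ∈ S
    V p nothing        = ⊥

    model : DSModel n
    model = record { frame = frame ; V = V }

    twin-fml : ∀ {y x φ} → Twin y x → Fml y φ ∈ S → Fml x φ ∈ S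
    twin-fml t p = typeOf-≡⇒ (sym (Twin.type≡ t)) (Fml∈probes (FmlOK.∈Cl (sound σ p))) p

    -- Induction on the formula. For `□`, `[i]` and `⊗` the witness may lie one rank outside the
    -- worlds, and its twin takes over both the formula and the accessibility. For `◇`, `⟨i⟩` and
    -- `⊖` the closure conditions reach whichever named world is offered.
    refute : ∀ φ (w : World) → Fml (proj₁ w) φ ∈ S → ¬ _⊩_ model (just w) φ
    refute (atom p)  w m h = clashless id-rule m h
    refute (natom p) w m h = h m
    refute (φ ∨ᶠ ψ)  w m (inj₁ h) = refute φ w (closed₁ ∨ˡ-rule m) h
    refute (φ ∨ᶠ ψ)  w m (inj₂ h) = refute ψ w (closed₁ ∨ʳ-rule m) h
    refute (φ ∧ᶠ ψ)  w m (h , h′) = [ (λ q → refute φ w q h) , (λ q → refute ψ w q h′) ]′ (branched ∧-rule m)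
    refute (□ᶠ φ) w m h =
      let y∈ = closed₁ (□-rule (world-rank w)) m
          b , q = LiveOK.made (sound σ y∈)
          v , t = inn-representative (nothing , φ) w y∈
      in refute φ v (twin-fml t q) (h (just v) (box-trans b (twin-box y∈ (proj₁ (proj₂ v)) t)))
    refute (◇ᶠ φ) w m (just v , b , h) = refute φ v (closed₂ ◇-rule m b) h
    refute ([ i ]ᶠ φ) w m h =
      let y∈ = closed₁ ([]-rule (world-rank w)) m
          b , q = LiveOK.made (sound σ y∈)
          v , t = inn-representative (just i , φ) w y∈
      in refute φ v (twin-fml t q) (h (just v) (cell-twin b (proj₁ (proj₂ v)) t))
    refute (⟨ i ⟩ᶠ φ) w m (just v , (_ , w≼v , _) , h) =
      refute φ v (closed₁ Dia-Fml (dias w≼v (Cl-closed (FmlOK.∈Cl (sound σ m)) ⟨⟩◁) (closed₁ ⟨⟩-rule m))) h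
    refute (⊗ᶠ i φ) w m h =
      let y∈ = closed₁ (⊗-rule (world-rank w)) m
          e , q = LiveOK.made (sound σ y∈)
          v , t = out-representative (i , inj₁ φ) w y∈
      in refute φ v (twin-fml t q) (h (just v) (ought-twin e t))
    refute (⊖ᶠ i φ) w m (just v , e , h) = refute φ v (closed₂ ⊖-rule m e) h
    -- The extra world succeeds only worlds of level at least `maxLevel`, where the depth bound
    -- admits no formula.
    refute (⊖ᶠ i φ) w m (nothing , le , _) =
      ℕₚ.<-irrefl refl (≤-trans (s≤s le) (≤-trans (s≤s (m≤n+m _ (suc (depth φ)))) (FmlOK.depth< (sound σ m))))

    module _ (S₀⊆S : S₀ ⊆ S) where

      rootWorld : ∀ {l} → l ∈ Roots → World
      rootWorld {l} l∈ = root l , S₀⊆S (live∈S₀ l∈) , z≤n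

      -- Labels outside `Roots` do not occur in the sequent, and the extra world serves as their
      -- default value.
      interpret : Label → Maybe World
      interpret l with DecMembership._∈?_ ℕₚ._≟_ l Roots
      ... | yes l∈ = just (rootWorld l∈)
      ... | no _   = nothing

      interpret-root : ∀ {l} → l ∈ Roots → ∃ λ (l∈ : l ∈ Roots) → interpret l ≡ just (rootWorld l∈)
      interpret-root {l} l∈ with DecMembership._∈?_ ℕₚ._≟_ l Roots
      ... | yes l∈′ = l∈′ , refl
      ... | no l∉   = contradiction l∈ l∉

      holds : ∀ a → a ∈ R₀ → HoldsR model interpret a
      holds (R□ x y) p
        with _ , eq ← interpret-root (rel-root p (here refl)) | _ , eq′ ← interpret-root (rel-root p (there (here refl)))
        rewrite eq | eq′ = S₀⊆S (rel∈S₀ p)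
      holds (R[] i x y) p
        with _ , eq ← interpret-root (rel-root p (here refl)) | _ , eq′ ← interpret-root (rel-root p (there (here refl)))
        rewrite eq | eq′ = cell-choice (S₀⊆S (rel∈S₀ p))
      holds (R⊗ i x y) p
        with _ , eq ← interpret-root (rel-root p (here refl)) | _ , eq′ ← interpret-root (rel-root p (there (here refl)))
        rewrite eq | eq′ = S₀⊆S (rel∈S₀ p)

      invalid : ¬ Valid X R₀ Γ₀
      invalid valid =
        let (x ∶ φ) , A∈ , h = find (valid model satX interpret (All.tabulate λ {a} → holds a))
            l∈ , eq = interpret-root (fml-root A∈)
        in refute φ (rootWorld l∈) (S₀⊆S (fml∈S₀ A∈)) (subst (λ w → _⊩_ model w φ) eq h)

  complete : Valid X R₀ Γ₀ → Derivable X R₀ Γ₀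
  complete valid = search initial λ σ S₀⊆S sat → Countermodel.invalid σ sat S₀⊆S valid

theoremA3 : (n : ℕ) → 1 ≤ n → (X : Ext) →
    (R : List (RAtom n)) (Γ : List (LFm n)) →
    Valid X R Γ → Derivable X R Γ
theoremA3 (suc m) _ X R Γ = Completeness.complete m X R Γ
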